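{- For every finite simple graph $G$ with maximal simplex dimension $r$, the squared analytic torsion $A(G)=\prod_{k=0}^{r}\mathrm{Det}(L_k)^{k(-1)^{k+1}}$ satisfies $$A(G)=\mathrm{SDet}(D)=\prod_{k=0}^{r}\mathrm{Det}(D_k)^{(-1)^{k}},$$ where $D_k=d_k^*d_k$ are the Dirac blocks.
   Context: Let $G=(V,E)$ be a finite simple graph. A $k$-simplex of $G$ is (the vertex set of) a complete subgraph $K_{k+1}$; $f_k$ is the number of $k$-simplices, and $r$ is the maximal dimension of a simplex. Order the vertices; for a $(k+1)$-simplex $x=\{v_0<\dots<v_{k+1}\}$ and $y=x\setminus\{v_i\}$ put $\mathrm{sign}(y,x)=(-1)^i$. The exterior derivative $d_k$ is the $f_{k+1}\times f_k$ matrix given by $d_kf(x)=\sum_{y\subset x,\ \dim y=k}\mathrm{sign}(y,x)f(y)$ (with $d_{ -1}=0$, $d_r=0$). These assemble to a matrix $d$ on the space of functions on all simplices; $D=d+d^*$ is the Dirac operator and $L=D^2$ the Hodge Laplacian, with diagonal blocks $L_k=d_k^*d_k+d_{k-1}d_{k-1}^*$. The Dirac blocks are $D_k=d_k^*d_k$. The pseudo determinant $\mathrm{Det}(M)$ of a square matrix $M$ is the product of its non-zero eigenvalues, counted with multiplicity (equal to $1$ if there are none). The super pseudo determinant of $D$ is by definition $\mathrm{SDet}(D)=\prod_k\mathrm{Det}(D_k)^{(-1)^k}$. -}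

module Defs where

open import Algebra.Apartness.Bundles using (HeytingField; HeytingCommutativeRing)
open import Algebra.Bundles using (CommutativeRing; Semiring)
import Algebra.Definitions.RawSemiring as RawSemiringDefs
open import Data.Bool.Base using (if_then_else_)
open import Data.Fin.Base as Fin using (Fin; zero; suc; toℕ; punchIn)
import Data.Fin.Properties as Fin
open import Data.Integer.Base as ℤ using (ℤ; +_; -[1+_])
open import Data.List.Base as List using (List; []; _∷_)
open import Data.Nat.Base as ℕ using (ℕ; zero; suc)
open import Data.Product.Base using (∃; _×_; proj₁)
open import Data.Vec.Base as Vec using (Vec; []; _∷_)
open import Data.Vec.Functional using (Vector)
open import Data.Vec.Properties using (≡-dec)
open import Data.Vec.Relation.Unary.AllPairs using (AllPairs; allPairs?)
open import Level using (0ℓ; _⊔_)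
open import Relation.Binary.Core using (Rel)
open import Relation.Binary.Definitions using (Decidable; Symmetric; DecidableEquality)
open import Relation.Nullary using (¬_; yes; no; does; _×-dec_)
import Relation.Unary as U

-- The total order on the vertices used to orient simplices is the usual order
-- of Fin order; as every labelling of a graph is allowed, so is every ordering.
record Graph : Set₁ where
  field
    order   : ℕ
    Adj     : Rel (Fin order) 0ℓ
    adj?    : Decidable Adj
    symm    : Symmetric Adj
    irrefl  : ∀ v → ¬ Adj v v

module _ (G : Graph) where
  open Graph G

  -- A k-simplex {v₀ < … < v_k} is represented by its increasing list of
  -- vertices, so that equality of simplices is propositional equality.
  IsSimplex : ∀ {k} → Vec (Fin order) (suc k) → Set
  IsSimplex = AllPairs (λ u v → u Fin.< v × Adj u v)

  isSimplex? : ∀ {k} → U.Decidable (IsSimplex {k})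
  isSimplex? = allPairs? (λ u v → (u Fin.<? v) ×-dec adj? u v)

  _≟ᵛ_ : ∀ {m} → DecidableEquality (Vec (Fin order) m)
  _≟ᵛ_ = ≡-dec Fin._≟_

  IsMaxDim : ℕ → Set
  IsMaxDim r = ∃ (IsSimplex {r}) × (∀ {k} (x : Vec (Fin order) (suc k)) → IsSimplex x → k ℕ.≤ r)

  tuples : ∀ m → List (Vec (Fin order) m)
  tuples zero    = [] ∷ []
  tuples (suc m) = List.cartesianProductWith _∷_ (List.allFin order) (tuples m)

  simplices : ∀ k → List (Vec (Fin order) (suc k))
  simplices k = List.filter isSimplex? (tuples (suc k))

  f : ℕ → ℕ
  f k = List.length (simplices k)

  simplex : ∀ {k} → Fin (f k) → Vec (Fin order) (suc k)
  simplex {k} = List.lookup (simplices k)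

-- The scalars: a Heyting field with decidable apartness, i.e. a discrete field
-- (in which _#_ is the negation of _≈_).
module OverField {c ℓ₁ ℓ₂} (K : HeytingField c ℓ₁ ℓ₂)
                 (_#?_ : Decidable (HeytingField._#_ K)) where

  open HeytingField K using (Carrier; _≈_; _#_; _+_; _*_; -_; _-_; 0#; 1#; #⇒invertible)

  private
    commutativeRing : CommutativeRing c ℓ₁
    commutativeRing = HeytingCommutativeRing.commutativeRing (HeytingField.heytingCommutativeRing K)

  open RawSemiringDefs (Semiring.rawSemiring (CommutativeRing.semiring commutativeRing)) public
    using (sum; product; _^_) renaming (_×_ to _·_)

  CharZero : Set ℓ₂
  CharZero = ∀ n → (suc n · 1#) # 0#

  -- Totalised by 0⁻¹ = 0; below it is only applied to pseudo determinants,
  -- which are never zero.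
  _⁻¹ : Carrier → Carrier
  x ⁻¹ with x #? 0#
  ... | yes x#0 = proj₁ (#⇒invertible x#0)
  ... | no  _   = 0#

  infixr 8 _^ᶻ_
  _^ᶻ_ : Carrier → ℤ → Carrier
  x ^ᶻ (+ n)    = x ^ n
  x ^ᶻ -[1+ n ] = (x ⁻¹) ^ suc n

  Matrix : ℕ → ℕ → Set c
  Matrix m n = Fin m → Fin n → Carrier

  _⊞_ : ∀ {m n} → Matrix m n → Matrix m n → Matrix m n
  (A ⊞ B) i j = A i j + B i j

  _⊠_ : ∀ {m n p} → Matrix m n → Matrix n p → Matrix m p
  (A ⊠ B) i j = sum (λ k → A i k * B k j)

  _ᵀ : ∀ {m n} → Matrix m n → Matrix n m
  (A ᵀ) i j = A j i

  scalar : ∀ {n} → Carrier → Matrix n n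
  scalar t i j = if does (i Fin.≟ j) then t else 0#

  det : ∀ {n} → Matrix n n → Carrier
  det {zero}  A = 1#
  det {suc n} A = sum (λ j → (- 1#) ^ toℕ j * (A zero j * det (λ a b → A (suc a) (punchIn j b))))

  -- The eigenvalues of A in K, repeated according to multiplicity as roots of
  -- the characteristic polynomial.  The factorisation is stated for polynomial
  -- functions, which over an infinite field amounts to the one for polynomials.
  record Eigenvalues {n} (A : Matrix n n) : Set (c ⊔ ℓ₁) where
    field
      eigenvalue : Vector Carrier n
      charPoly   : ∀ t → det (λ i j → scalar t i j - A i j) ≈ product (λ i → t - eigenvalue i)

  Det : ∀ {n} {A : Matrix n n} → Eigenvalues A → Carrier
  Det E = product (λ i → if does (eigenvalue i #? 0#) then eigenvalue i else 1#)
    where open Eigenvalues E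

  module _ (G : Graph) where
    open Graph G

    -- sign(y,x) if y is a face of x, and 0 otherwise: the vertices of a simplex
    -- being distinct, at most one summand is non-zero.
    incidence : ∀ {k} → Vec (Fin order) (suc (suc k)) → Vec (Fin order) (suc k) → Carrier
    incidence x y = sum (λ i → if does (_≟ᵛ_ G y (Vec.removeAt x i)) then (- 1#) ^ toℕ i else 0#)

    d : ∀ k → Matrix (f G (suc k)) (f G k)
    d k x y = incidence (simplex G x) (simplex G y)

    -- d has integer entries, so d* is the transpose.
    D : ∀ k → Matrix (f G k) (f G k)
    D k = (d k ᵀ) ⊠ d k

    -- d₋₁ = 0.
    L : ∀ k → Matrix (f G k) (f G k)
    L zero    = D zero
    L (suc k) = D (suc k) ⊞ (d k ⊠ (d k ᵀ))

    torsion : ∀ r → (∀ (k : Fin (suc r)) → Eigenvalues (L (toℕ k))) → Carrier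
    torsion r E = product (λ k → Det (E k) ^ᶻ ((+ toℕ k) ℤ.* ((ℤ.- (+ 1)) ℤ.^ suc (toℕ k))))

    SDet : ∀ r → (∀ (k : Fin (suc r)) → Eigenvalues (D (toℕ k))) → Carrier
    SDet r E = product (λ k → Det (E k) ^ᶻ ((ℤ.- (+ 1)) ℤ.^ toℕ k))

{-# OPTIONS --safe #-}
module Submission where

-- Since d d = 0, the matrices X = d_k* d_k and Y = d_{k-1} d_{k-1}* satisfy XY = 0,
-- so det (t + X) det (t + Y) = tⁿ det (t + L_k).  Moreover det (t + d d*) and
-- det (t + d* d) agree up to powers of t.  Comparing lowest non-zero coefficients
-- gives Det L_k = Det D_k Det D_{k-1}, and the alternating product telescopes, its
-- last factor being Det D_r = 1.

open import Defs
open import Algebra.Apartness.Bundles using (HeytingField; HeytingCommutativeRing)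
open import Algebra.Bundles using (CommutativeRing)
import Algebra.Properties.CommutativeSemiring.Exp as CommutativeSemiringExp
import Algebra.Properties.Ring as RingProperties
import Algebra.Properties.Semiring.Exp as SemiringExp
import Algebra.Properties.Semiring.Sum as SemiringSum
import Algebra.Solver.Ring.NaturalCoefficients.Default as SemiringSolver
open import Data.Bool.Base using (true; false; if_then_else_)
open import Data.Fin.Base as Fin using (Fin; zero; suc; toℕ; punchIn; pinch; _↑ˡ_; _↑ʳ_)
import Data.Fin.Properties as Fin
open import Data.Integer.Base as ℤ using (ℤ; +_; -[1+_])
import Data.Integer.Properties as ℤ
open import Data.Integer.Solver using (module +-*-Solver)
open import Data.List.Base as List using (List; _∷_)
open import Data.List.Membership.Propositional using (_∈_)
open import Data.List.Membership.Propositional.Properties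
  using (∈-filter⁺; ∈-filter⁻; ∈-cartesianProductWith⁺; ∈-allFin; ∈-lookup)
open import Data.List.Relation.Unary.All as ListAll using ()
open import Data.List.Relation.Unary.AllPairs using ([]; _∷_)
open import Data.List.Relation.Unary.Any using (here; there)
open import Data.List.Relation.Unary.Unique.Propositional using (Unique)
open import Data.List.Relation.Unary.Unique.Propositional.Properties using (filter⁺; cartesianProductWith⁺; allFin⁺)
open import Data.Nat.Base as ℕ using (ℕ; zero; suc)
import Data.Nat.Properties as ℕ
open import Data.Product.Base using (∃; _×_; _,_; proj₁; proj₂)
open import Data.Vec.Base as Vec using (Vec; []; _∷_)
open import Data.Vec.Functional using (Vector; _++_) renaming (_∷_ to infixr 5 _∷ᵛ_)
open import Data.Vec.Functional.Properties using (lookup-++ˡ; lookup-++ʳ)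
open import Data.Vec.Properties using (∷-injective)
open import Data.Vec.Relation.Unary.All using (All; _∷_)
open import Data.Vec.Relation.Unary.AllPairs using (AllPairs; _∷_)
open import Level using (_⊔_)
open import Relation.Binary.Definitions using (Decidable; DecidableEquality)
open import Relation.Binary.PropositionalEquality as ≡ using (_≡_)
import Relation.Binary.Reasoning.Setoid as SetoidReasoning
open import Relation.Nullary using (contradiction; ¬_; yes; no; does)

-- Determinants are given by expansion along the first row and spectra by factorisations of the
-- function t ↦ det (t - A), so the multiplicativity of `det` has to be established first. It
-- follows from uniqueness: an alternating form on the rows of a square matrix is `det` times its
-- value at the identity. One cancellation lemma, `alternating-sum`, serves twice: two equal rows
-- make a determinant vanish for the same reason that d d = 0, because two positions can be deleted
-- in either order, with opposite signs. The eigenvalues of L_k and of D_k are chosen independently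
-- and are compared only through the functions of t that they factor. Setting t = 0 in an identity
-- with powers of t on both sides says nothing. Common powers are therefore cancelled at t = 1, 2,
-- 3, ..., which are invertible in characteristic zero, and the remaining equality of polynomial
-- functions is extended to t = 0. The multiplicity of the eigenvalue 0 stays an unknown exponent
-- throughout.

punchIn-pinch : ∀ {n} (i : Fin (suc n)) (j : Fin n) → punchIn (punchIn i j) (pinch j i) ≡ i
punchIn-pinch {suc n} zero    j       = ≡.refl
punchIn-pinch {suc n} (suc i) zero    = ≡.refl
punchIn-pinch {suc n} (suc i) (suc j) = ≡.cong suc (punchIn-pinch i j)

-- Both sides enumerate in increasing order the positions left after removing `i` and `punchIn i j`;
-- the two are removed in opposite orders.
punchIn-punchIn : ∀ {n} (i : Fin (suc (suc n))) (j : Fin (suc n)) (k : Fin n) →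
  punchIn i (punchIn j k) ≡ punchIn (punchIn i j) (punchIn (pinch j i) k)
punchIn-punchIn zero    j       k       = ≡.refl
punchIn-punchIn (suc i) zero    k       = ≡.refl
punchIn-punchIn (suc i) (suc j) zero    = ≡.refl
punchIn-punchIn (suc i) (suc j) (suc k) = ≡.cong suc (punchIn-punchIn i j k)

punchIn-↑ˡ-↑ˡ : ∀ {m} n (j : Fin (suc m)) (b : Fin m) → punchIn (j ↑ˡ n) (b ↑ˡ n) ≡ punchIn j b ↑ˡ n
punchIn-↑ˡ-↑ˡ n zero    b       = ≡.refl
punchIn-↑ˡ-↑ˡ n (suc j) zero    = ≡.refl
punchIn-↑ˡ-↑ˡ n (suc j) (suc b) = ≡.cong suc (punchIn-↑ˡ-↑ˡ n j b)

punchIn-↑ˡ-↑ʳ : ∀ {m n} (j : Fin (suc m)) (b : Fin n) → punchIn (j ↑ˡ n) (m ↑ʳ b) ≡ suc m ↑ʳ b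
punchIn-↑ˡ-↑ʳ         zero    b = ≡.refl
punchIn-↑ˡ-↑ʳ {suc m} (suc j) b = ≡.cong suc (punchIn-↑ˡ-↑ʳ j b)

-- Alternating sums and alternating forms on the rows of a matrix.

module Determinants {c ℓ₁ ℓ₂} (K : HeytingField c ℓ₁ ℓ₂) (_#?_ : Decidable (HeytingField._#_ K)) where

  open OverField K _#?_ using (_^_; Matrix; scalar)

  R : CommutativeRing c ℓ₁
  R = HeytingCommutativeRing.commutativeRing (HeytingField.heytingCommutativeRing K)

  open CommutativeRing R hiding (zero)
  open SemiringSum semiring
  open SemiringExp semiring using ()
  open RingProperties ring using (-1*x≈-x; +-cancelˡ)
  open SemiringSolver commutativeSemiring using (solve; _:=_; _:+_; _:*_)
  open SetoidReasoning setoid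

  -- The solver in use works over commutative semirings and has no negation, so signs are treated as
  -- powers of an atom, and cancellations go through `ε*x+x≈0`.
  ε : Carrier
  ε = - 1#

  ε*x+x≈0 : ∀ x → ε * x + x ≈ 0#
  ε*x+x≈0 x = trans (+-congʳ (-1*x≈-x x)) (-‿inverseˡ x)

  x+y≈0⇒x≈ε*y : ∀ {x y} → x + y ≈ 0# → x ≈ ε * y
  x+y≈0⇒x≈ε*y {x} {y} x+y≈0 = begin
    x                 ≈⟨ +-identityʳ x ⟨
    x + 0#            ≈⟨ +-congˡ (ε*x+x≈0 y) ⟨
    x + (ε * y + y)   ≈⟨ solve 3 (λ x e y → x :+ (e :+ y) := e :+ (x :+ y)) refl x (ε * y) y ⟩
    ε * y + (x + y)   ≈⟨ +-congˡ x+y≈0 ⟩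
    ε * y + 0#        ≈⟨ +-identityʳ _ ⟩
    ε * y             ∎

  x≈x+x⇒x≈0 : ∀ {x} → x ≈ x + x → x ≈ 0#
  x≈x+x⇒x≈0 {x} x≈x+x = sym (+-cancelˡ x _ _ (trans (+-identityʳ x) x≈x+x))

  sum-zero : ∀ n {f : Vector Carrier n} → (∀ i → f i ≈ 0#) → sum f ≈ 0#
  sum-zero n {f} f≈0 = trans (sum-cong-≋ {n} {f} {λ _ → 0#} f≈0) (sum-replicate-zero n)

  ∑-cong : ∀ n {f g : Vector Carrier n} → (∀ i → f i ≈ g i) → sum f ≈ sum g
  ∑-cong n {f} {g} f≈g = sum-cong-≋ {n} {f} {g} f≈g

  sum-++ : ∀ m {n} (f : Fin (m ℕ.+ n) → Carrier) →
    sum f ≈ sum (λ i → f (i ↑ˡ n)) + sum (λ i → f (m ↑ʳ i))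
  sum-++ zero    f = sym (+-identityˡ _)
  sum-++ (suc m) f = trans (+-congˡ (sum-++ m (λ i → f (suc i)))) (sym (+-assoc _ _ _))

  -- The involution (i , j) ↦ (punchIn i j , pinch j i) exchanges the two orders
  -- in which a pair of positions can be deleted, and changes the parity of i + j.
  alternating-sum : ∀ {n} (g : Fin (suc n) → Fin n → Carrier) →
    (∀ i j → g i j ≈ g (punchIn i j) (pinch j i)) →
    sum (λ i → ε ^ toℕ i * sum (λ j → ε ^ toℕ j * g i j)) ≈ 0#
  alternating-sum {zero}  g g-sym = sum-zero 1 (λ i → zeroʳ (ε ^ toℕ i))
  alternating-sum {suc n} g g-sym = begin
    1# * S₀ + sum (λ i → (ε * ε ^ toℕ i) * (1# * g (suc i) zero + sum (λ j → (ε * ε ^ toℕ j) * g (suc i) (suc j))))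
      ≈⟨ +-cong (*-identityˡ S₀) (∑-cong (suc n) split) ⟩
    S₀ + sum (λ i → ε * T i + (ε * ε) * U i)
      ≈⟨ +-congˡ (∑-distrib-+ (λ i → ε * T i) (λ i → (ε * ε) * U i)) ⟩
    S₀ + (sum (λ i → ε * T i) + sum (λ i → (ε * ε) * U i))
      ≈⟨ +-congˡ (+-cong (*-distribˡ-sum ε T) (*-distribˡ-sum (ε * ε) U)) ⟨
    S₀ + (ε * sum T + (ε * ε) * sum U)
      ≈⟨ +-congˡ (+-congˡ (trans (*-congˡ (alternating-sum (λ i j → g (suc i) (suc j)) (λ i j → g-sym (suc i) (suc j)))) (zeroʳ _))) ⟩
    S₀ + (ε * sum T + 0#)
      -- The involution sends (0, j) to (j + 1, 0), so `S₀` equals `sum T`, which the other border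
      -- carries with one more factor `ε`. The interior, where neither index is 0, has already
      -- vanished by induction.
      ≈⟨ +-cong (∑-cong (suc n) {λ j → ε ^ toℕ j * g zero j} {T} (λ j → *-congˡ (g-sym zero j))) (+-identityʳ _) ⟩
    sum T + ε * sum T
      ≈⟨ trans (+-comm _ _) (ε*x+x≈0 (sum T)) ⟩
    0# ∎
    where
    S₀ : Carrier
    S₀ = sum (λ j → ε ^ toℕ j * g zero j)
    T U : Fin (suc n) → Carrier
    T i = ε ^ toℕ i * g (suc i) zero
    U i = ε ^ toℕ i * sum (λ j → ε ^ toℕ j * g (suc i) (suc j))
    split : ∀ i → (ε * ε ^ toℕ i) * (1# * g (suc i) zero + sum (λ j → (ε * ε ^ toℕ j) * g (suc i) (suc j)))
      ≈ ε * T i + (ε * ε) * U i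
    split i = begin
      (ε * ε ^ toℕ i) * (1# * g (suc i) zero + sum (λ j → (ε * ε ^ toℕ j) * g (suc i) (suc j)))
        ≈⟨ *-congˡ (+-cong (*-identityˡ _) (trans (∑-cong n (λ j → *-assoc ε (ε ^ toℕ j) (g (suc i) (suc j)))) (sym (*-distribˡ-sum ε (λ j → ε ^ toℕ j * g (suc i) (suc j)))))) ⟩
      (ε * ε ^ toℕ i) * (g (suc i) zero + ε * sum (λ j → ε ^ toℕ j * g (suc i) (suc j)))
        ≈⟨ solve 4 (λ e p x y → (e :* p) :* (x :+ e :* y) := e :* (p :* x) :+ (e :* e) :* (p :* y)) refl ε (ε ^ toℕ i) _ _ ⟩
      ε * T i + (ε * ε) * U i ∎

  infix 4 _≋_ _≐_

  _≋_ : ∀ {n} → Vector Carrier n → Vector Carrier n → Set ℓ₁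
  u ≋ v = ∀ j → u j ≈ v j

  _≐_ : ∀ {m n} → Matrix m n → Matrix m n → Set ℓ₁
  A ≐ B = ∀ i → A i ≋ B i

  ∷-cong : ∀ {m n} {r s : Vector Carrier n} {T U : Matrix m n} → r ≋ s → T ≐ U → (r ∷ᵛ T) ≐ (s ∷ᵛ U)
  ∷-cong r≋s T≐U zero    = r≋s
  ∷-cong r≋s T≐U (suc i) = T≐U i

  ∷-η : ∀ {m n} (A : Matrix (suc m) n) → A ≐ (A zero ∷ᵛ (λ i → A (suc i)))
  ∷-η A zero    j = refl
  ∷-η A (suc i) j = refl

  ∷-congʳ : ∀ {m n} {r s : Vector Carrier n} {T : Matrix m n} → r ≋ s → (r ∷ᵛ T) ≐ (s ∷ᵛ T)
  ∷-congʳ r≋s = ∷-cong r≋s (λ i j → refl)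

  ∷-congˡ : ∀ {m n} {r : Vector Carrier n} {T U : Matrix m n} → T ≐ U → (r ∷ᵛ T) ≐ (r ∷ᵛ U)
  ∷-congˡ = ∷-cong (λ j → refl)

  -- One operation expresses both halves of linearity: `a = 1#` is additivity, which already forces
  -- the value 0 on the zero row, and homogeneity follows.
  axpy : ∀ {n} → Carrier → Vector Carrier n → Vector Carrier n → Vector Carrier n
  axpy a u v j = a * u j + v j

  minor : ∀ {m n} → Fin (suc n) → Matrix m (suc n) → Matrix m n
  minor j T a b = T a (punchIn j b)

  -- Matrices are functions with values in a setoid, so invariance under entrywise equality has to
  -- be carried along as a property of the form.
  Congruent : ∀ {m n} → (Matrix m n → Carrier) → Set (c ⊔ ℓ₁)
  Congruent F = ∀ {A B} → A ≐ B → F A ≈ F B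

  -- Only adjacent equal rows are required to annihilate the form; the index i
  -- with toℕ i ≡ 0 stands for the first row of T, without splitting on m.
  data Alternating {n : ℕ} : ∀ {m} → (Matrix m n → Carrier) → Set (c ⊔ ℓ₁) where
    nil  : ∀ {F} → Alternating {m = zero} F
    cons : ∀ {m} {F : Matrix (suc m) n → Carrier} →
      (∀ T a u v → F (axpy a u v ∷ᵛ T) ≈ a * F (u ∷ᵛ T) + F (v ∷ᵛ T)) →
      (∀ T r i → toℕ i ≡ 0 → T i ≋ r → F (r ∷ᵛ T) ≈ 0#) →
      (∀ r → Alternating (λ T → F (r ∷ᵛ T))) →
      Alternating F

  linear-zero : ∀ {n} (g : Vector Carrier n → Carrier) → (∀ {u v} → u ≋ v → g u ≈ g v) →
    (∀ a u v → g (axpy a u v) ≈ a * g u + g v) → ∀ {u} → (∀ j → u j ≈ 0#) → g u ≈ 0#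
  linear-zero g g-cong lin {u} u≈0 = x≈x+x⇒x≈0 (begin
    g u                 ≈⟨ g-cong (λ j → trans (u≈0 j) (sym (trans (+-cong (trans (*-identityˡ _) (u≈0 j)) (u≈0 j)) (+-identityˡ 0#)))) ⟩
    g (axpy 1# u u)     ≈⟨ lin 1# u u ⟩
    1# * g u + g u      ≈⟨ +-congʳ (*-identityˡ _) ⟩
    g u + g u           ∎)

  linear-expand : ∀ {n} (g : Vector Carrier n → Carrier) → (∀ {u v} → u ≋ v → g u ≈ g v) →
    (∀ a u v → g (axpy a u v) ≈ a * g u + g v) →
    ∀ r → g r ≈ sum (λ j → r j * g (scalar 1# j))
  linear-expand {zero}  g g-cong lin r = linear-zero g g-cong lin (λ ())
  linear-expand {suc n} g g-cong lin r = begin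
    g r
      ≈⟨ g-cong (λ { zero → sym (trans (+-identityʳ _) (*-identityʳ _)) ; (suc j) → sym (trans (+-congʳ (zeroʳ _)) (+-identityˡ _)) }) ⟩
    g (axpy (r zero) (scalar 1# zero) (0# ∷ᵛ (λ j → r (suc j))))
      ≈⟨ lin _ _ _ ⟩
    r zero * g (scalar 1# zero) + g (0# ∷ᵛ (λ j → r (suc j)))
      ≈⟨ +-congˡ (linear-expand (λ u → g (0# ∷ᵛ u)) (λ u≋v → g-cong (λ { zero → refl ; (suc j) → u≋v j }))
           (λ a u v → trans (g-cong (λ { zero → sym (trans (+-identityʳ _) (zeroʳ a)) ; (suc j) → refl })) (lin a (0# ∷ᵛ u) (0# ∷ᵛ v)))
           (λ j → r (suc j))) ⟩
    r zero * g (scalar 1# zero) + sum (λ j → r (suc j) * g (0# ∷ᵛ scalar 1# j))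
      ≈⟨ +-congˡ (∑-cong n (λ j → *-congˡ (g-cong (λ { zero → refl ; (suc k) → refl })))) ⟩
    r zero * g (scalar 1# zero) + sum (λ j → r (suc j) * g (scalar 1# (suc j))) ∎

  module _ {n : ℕ} where

    tail-congruent : ∀ {m} {F : Matrix (suc m) n → Carrier} → Congruent F → ∀ r → Congruent (λ T → F (r ∷ᵛ T))
    tail-congruent F-cong r T≐U = F-cong (∷-congˡ T≐U)

    -- Polarisation: expanding the form at two equal rows r + s leaves only the two mixed terms.
    rows-swap : ∀ {m} {F : Matrix (suc (suc m)) n → Carrier} → Congruent F → Alternating F →
      ∀ r s T → F (r ∷ᵛ s ∷ᵛ T) ≈ ε * F (s ∷ᵛ r ∷ᵛ T)
    rows-swap {F = F} F-cong (cons lin alt altᵗ) r s T = x+y≈0⇒x≈ε*y (begin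
      F (r ∷ᵛ s ∷ᵛ T) + F (s ∷ᵛ r ∷ᵛ T)
        ≈⟨ +-cong (trans (lin₂ r) (trans (+-congʳ (diagonal r)) (+-identityˡ _)))
                  (trans (lin₂ s) (trans (+-congˡ (diagonal s)) (+-identityʳ _))) ⟨
      F (r ∷ᵛ w ∷ᵛ T) + F (s ∷ᵛ w ∷ᵛ T)
        ≈⟨ +-congʳ (*-identityˡ _) ⟨
      1# * F (r ∷ᵛ w ∷ᵛ T) + F (s ∷ᵛ w ∷ᵛ T)
        ≈⟨ lin (w ∷ᵛ T) 1# r s ⟨
      F (w ∷ᵛ w ∷ᵛ T)
        ≈⟨ diagonal w ⟩
      0# ∎)
      where
      w : Vector Carrier n
      w = axpy 1# r s
      diagonal : ∀ u → F (u ∷ᵛ u ∷ᵛ T) ≈ 0#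
      diagonal u = alt (u ∷ᵛ T) u zero ≡.refl (λ j → refl)
      lin₂ : ∀ u → F (u ∷ᵛ w ∷ᵛ T) ≈ F (u ∷ᵛ r ∷ᵛ T) + F (u ∷ᵛ s ∷ᵛ T)
      lin₂ u with altᵗ u
      ... | cons lin′ _ _ = trans (lin′ T 1# r s) (+-congʳ (*-identityˡ _))

-- Uniqueness of alternating forms and multiplicativity of the determinant.

module AlternatingForms {c ℓ₁ ℓ₂} (K : HeytingField c ℓ₁ ℓ₂) (_#?_ : Decidable (HeytingField._#_ K)) where

  open OverField K _#?_ using (_^_; Matrix; _⊠_; scalar; det)
  open Determinants K _#?_
  open CommutativeRing R hiding (zero)
  open SemiringSum semiring
  open SemiringSolver commutativeSemiring using (solve; _:=_; _:+_; _:*_)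
  open SetoidReasoning setoid

  -- Adjacent swaps carry `r` down past the rows in between until the two equal rows are neighbours.
  repeated-row : ∀ {m n} {F : Matrix (suc m) n → Carrier} → Congruent F → Alternating F →
    ∀ r T i → T i ≋ r → F (r ∷ᵛ T) ≈ 0#
  repeated-row F-cong (cons _ alt _) r T zero T₀≋r = alt T r zero ≡.refl T₀≋r
  repeated-row {suc m} {F = F} F-cong F-alt@(cons _ _ altᵗ) r T (suc i) Tᵢ≋r = begin
    F (r ∷ᵛ T)                ≈⟨ F-cong (∷-congˡ (∷-η T)) ⟩
    F (r ∷ᵛ T zero ∷ᵛ T′)      ≈⟨ rows-swap F-cong F-alt r (T zero) T′ ⟩
    ε * F (T zero ∷ᵛ r ∷ᵛ T′)  ≈⟨ *-congˡ (repeated-row (tail-congruent F-cong (T zero)) (altᵗ (T zero)) r T′ i Tᵢ≋r) ⟩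
    ε * 0#                   ≈⟨ zeroʳ ε ⟩
    0#                       ∎
    where
    T′ : Matrix m _
    T′ i = T (suc i)

  -- In the application `G` is a form with `e` fixed as an earlier row, hence zero when `e` recurs.
  -- Multiples of a unit row can then be used to clear a column below it.
  add-multiples : ∀ {m n} {G : Matrix m n → Carrier} → Congruent G → Alternating G →
    ∀ e → (∀ T i → T i ≋ e → G T ≈ 0#) →
    ∀ (a : Vector Carrier m) T → G (λ i → axpy (a i) e (T i)) ≈ G T
  add-multiples G-cong nil e G-e a T = G-cong (λ ())
  add-multiples {suc m} {G = G} G-cong (cons lin _ altᵗ) e G-e a T = begin
    G (λ i → axpy (a i) e (T i))
      ≈⟨ G-cong (∷-η _) ⟩
    G (axpy (a zero) e (T zero) ∷ᵛ U)
      ≈⟨ lin U (a zero) e (T zero) ⟩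
    a zero * G (e ∷ᵛ U) + G (T zero ∷ᵛ U)
      ≈⟨ +-cong (trans (*-congˡ (G-e (e ∷ᵛ U) zero (λ j → refl))) (zeroʳ _))
                (add-multiples (tail-congruent G-cong (T zero)) (altᵗ (T zero)) e
                  (λ T′ i → G-e (T zero ∷ᵛ T′) (suc i)) (λ i → a (suc i)) (λ i → T (suc i))) ⟩
    0# + G (T zero ∷ᵛ (λ i → T (suc i)))
      ≈⟨ +-identityˡ _ ⟩
    G (T zero ∷ᵛ (λ i → T (suc i)))
      ≈⟨ G-cong (∷-η T) ⟨
    G T ∎
    where
    U : Matrix m _
    U i = axpy (a (suc i)) e (T (suc i))

  record Linear {n p} (φ : Vector Carrier n → Vector Carrier p) : Set (c ⊔ ℓ₁) where
    field
      φ-cong : ∀ {u v} → u ≋ v → φ u ≋ φ v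
      φ-axpy : ∀ a u v → φ (axpy a u v) ≋ axpy a (φ u) (φ v)

  module _ {n p : ℕ} {φ : Vector Carrier n → Vector Carrier p} (φ-linear : Linear φ) where
    open Linear φ-linear

    map-∷ : ∀ {m} r (T : Matrix m n) → (λ i → φ ((r ∷ᵛ T) i)) ≐ (φ r ∷ᵛ (λ i → φ (T i)))
    map-∷ r T zero    j = refl
    map-∷ r T (suc i) j = refl

    map-congruent : ∀ {m} {F : Matrix m p → Carrier} → Congruent F → Congruent (λ A → F (λ i → φ (A i)))
    map-congruent F-cong A≐B = F-cong (λ i → φ-cong (A≐B i))

  alternating-cong : ∀ {m n} {F G : Matrix m n → Carrier} → (∀ A → F A ≈ G A) → Alternating F → Alternating G
  alternating-cong F≈G nil = nil
  alternating-cong F≈G (cons lin alt altᵗ) = cons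
    (λ T a u v → trans (sym (F≈G _)) (trans (lin T a u v) (+-cong (*-congˡ (F≈G _)) (F≈G _))))
    (λ T r i i≡0 Tᵢ≋r → trans (sym (F≈G _)) (alt T r i i≡0 Tᵢ≋r))
    (λ r → alternating-cong (λ T → F≈G (r ∷ᵛ T)) (altᵗ r))

  -- Two row maps matter: selecting columns, which makes the determinant of a minor an alternating
  -- form of the larger matrix, and right multiplication by `B`, which does the same for
  -- `A ↦ det (A ⊠ B)`.
  map-alternating : ∀ {m n p} {φ : Vector Carrier n → Vector Carrier p} {F : Matrix m p → Carrier} →
    Linear φ → Congruent F → Alternating F → Alternating (λ A → F (λ i → φ (A i)))
  map-alternating φ-linear F-cong nil = nil
  map-alternating {φ = φ} {F} φ-linear F-cong (cons lin alt altᵗ) = cons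
    (λ T a u v → begin
      F (λ i → φ ((axpy a u v ∷ᵛ T) i))
        ≈⟨ F-cong (λ i j → trans (map-∷ φ-linear _ T i j) (∷-congʳ (φ-axpy a u v) i j)) ⟩
      F (axpy a (φ u) (φ v) ∷ᵛ (λ i → φ (T i)))
        ≈⟨ lin _ a (φ u) (φ v) ⟩
      a * F (φ u ∷ᵛ (λ i → φ (T i))) + F (φ v ∷ᵛ (λ i → φ (T i)))
        ≈⟨ +-cong (*-congˡ (F-cong (map-∷ φ-linear u T))) (F-cong (map-∷ φ-linear v T)) ⟨
      a * F (λ i → φ ((u ∷ᵛ T) i)) + F (λ i → φ ((v ∷ᵛ T) i)) ∎)
    (λ T r i i≡0 Tᵢ≋r → trans (F-cong (map-∷ φ-linear r T)) (alt _ (φ r) i i≡0 (φ-cong Tᵢ≋r)))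
    (λ r → alternating-cong (λ T → sym (F-cong (map-∷ φ-linear r T)))
      (map-alternating φ-linear (tail-congruent F-cong (φ r)) (altᵗ (φ r))))
    where open Linear φ-linear

  combination-alternating : ∀ p {m n} (a : Fin p → Carrier) (F : Fin p → Matrix m n → Carrier) →
    (∀ j → Alternating (F j)) → Alternating (λ A → sum (λ j → a j * F j A))
  combination-alternating p {zero}  a F F-alt = nil
  combination-alternating p {suc m} a F F-alt = cons
    (λ T b u v → begin
      sum (λ j → a j * F j (axpy b u v ∷ᵛ T))
        ≈⟨ ∑-cong p (λ j → trans (*-congˡ (lin (F-alt j) T b u v))
             (solve 4 (λ a b x y → a :* (b :* x :+ y) := b :* (a :* x) :+ a :* y) refl (a j) b (F j (u ∷ᵛ T)) (F j (v ∷ᵛ T)))) ⟩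
      sum (λ j → b * (a j * F j (u ∷ᵛ T)) + a j * F j (v ∷ᵛ T))
        ≈⟨ ∑-distrib-+ {p} (λ j → b * (a j * F j (u ∷ᵛ T))) (λ j → a j * F j (v ∷ᵛ T)) ⟩
      sum (λ j → b * (a j * F j (u ∷ᵛ T))) + sum (λ j → a j * F j (v ∷ᵛ T))
        ≈⟨ +-congʳ (*-distribˡ-sum {p} b (λ j → a j * F j (u ∷ᵛ T))) ⟨
      b * sum (λ j → a j * F j (u ∷ᵛ T)) + sum (λ j → a j * F j (v ∷ᵛ T)) ∎)
    (λ T r i i≡0 Tᵢ≋r → sum-zero p (λ j → trans (*-congˡ (adj (F-alt j) T r i i≡0 Tᵢ≋r)) (zeroʳ (a j))))
    (λ r → combination-alternating p a (λ j T → F j (r ∷ᵛ T)) (λ j → tl (F-alt j) r))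
    where
    lin : ∀ {G : Matrix (suc m) _ → Carrier} → Alternating G → ∀ T b u v → G (axpy b u v ∷ᵛ T) ≈ b * G (u ∷ᵛ T) + G (v ∷ᵛ T)
    lin (cons p _ _) = p
    adj : ∀ {G : Matrix (suc m) _ → Carrier} → Alternating G → ∀ T r i → toℕ i ≡ 0 → T i ≋ r → G (r ∷ᵛ T) ≈ 0#
    adj (cons _ q _) = q
    tl : ∀ {G : Matrix (suc m) _ → Carrier} → Alternating G → ∀ r → Alternating (λ T → G (r ∷ᵛ T))
    tl (cons _ _ r) = r

  det-cong : ∀ n → Congruent (det {n})
  det-cong zero    A≐B = refl
  det-cong (suc n) A≐B = ∑-cong (suc n) (λ j →
    *-congˡ {x = ε ^ toℕ j} (*-cong (A≐B zero j) (det-cong n (λ a b → A≐B (suc a) (punchIn j b)))))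

  select-linear : ∀ {n p} (σ : Fin p → Fin n) → Linear (λ r j → r (σ j))
  select-linear σ = record { φ-cong = λ u≋v j → u≋v (σ j) ; φ-axpy = λ a u v j → refl }

  -- Expansion along both equal rows is a double alternating sum over ordered pairs of distinct
  -- columns. The product of entries and the complementary minor depend only on the unordered pair,
  -- so `alternating-sum` applies.
  det-repeated : ∀ {n} (T : Matrix (suc n) (suc (suc n))) r → T zero ≋ r → det (r ∷ᵛ T) ≈ 0#
  det-repeated {n} T r T₀≋r = begin
    sum (λ i → ε ^ toℕ i * (r i * sum (λ j → ε ^ toℕ j * (T zero (punchIn i j) * Δ i j))))
      ≈⟨ ∑-cong (suc (suc n)) (λ i → *-congˡ {x = ε ^ toℕ i} (trans (*-distribˡ-sum {suc n} (r i) (λ j → ε ^ toℕ j * (T zero (punchIn i j) * Δ i j)))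
           (∑-cong (suc n) (λ j → trans
             (solve 4 (λ p q x y → p :* (q :* (x :* y)) := q :* ((p :* x) :* y)) refl (r i) (ε ^ toℕ j) (T zero (punchIn i j)) (Δ i j))
             (*-congˡ {x = ε ^ toℕ j} (*-congʳ (*-congˡ (T₀≋r (punchIn i j))))))))) ⟩
    sum (λ i → ε ^ toℕ i * sum (λ j → ε ^ toℕ j * ((r i * r (punchIn i j)) * Δ i j)))
      ≈⟨ alternating-sum (λ i j → (r i * r (punchIn i j)) * Δ i j) symmetric ⟩
    0# ∎
    where
    Δ : Fin (suc (suc n)) → Fin (suc n) → Carrier
    Δ i j = det (λ a b → T (suc a) (punchIn i (punchIn j b)))
    symmetric : ∀ i j → (r i * r (punchIn i j)) * Δ i j
      ≈ (r (punchIn i j) * r (punchIn (punchIn i j) (pinch j i))) * Δ (punchIn i j) (pinch j i)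
    symmetric i j = *-cong
      (trans (*-comm _ _) (*-congˡ (reflexive (≡.cong r (≡.sym (punchIn-pinch i j))))))
      (det-cong n (λ a b → reflexive (≡.cong (T (suc a)) (punchIn-punchIn i j b))))

  -- With the first row fixed, the expansion is a linear combination of determinants of minors,
  -- alternating by induction. Only the equality of the first two rows needs an argument of its own,
  -- `det-repeated`.
  det-alternating : ∀ n → Alternating (det {n})
  det-alternating zero    = nil
  det-alternating (suc n) = cons
    (λ T a u v → begin
      sum (λ j → ε ^ toℕ j * ((a * u j + v j) * det (minor j T)))
        ≈⟨ ∑-cong (suc n) (λ j → solve 5 (λ e a u v d → e :* ((a :* u :+ v) :* d) := a :* (e :* (u :* d)) :+ e :* (v :* d))
             refl (ε ^ toℕ j) a (u j) (v j) (det (minor j T))) ⟩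
      sum (λ j → a * (ε ^ toℕ j * (u j * det (minor j T))) + ε ^ toℕ j * (v j * det (minor j T)))
        ≈⟨ ∑-distrib-+ {suc n} (λ j → a * (ε ^ toℕ j * (u j * det (minor j T)))) (λ j → ε ^ toℕ j * (v j * det (minor j T))) ⟩
      sum (λ j → a * (ε ^ toℕ j * (u j * det (minor j T)))) + det (v ∷ᵛ T)
        ≈⟨ +-congʳ (*-distribˡ-sum {suc n} a (λ j → ε ^ toℕ j * (u j * det (minor j T)))) ⟨
      a * det (u ∷ᵛ T) + det (v ∷ᵛ T) ∎)
    (alt n)
    (λ r → alternating-cong
      (λ T → ∑-cong (suc n) (λ j → *-assoc (ε ^ toℕ j) (r j) (det (minor j T))))
      (combination-alternating (suc n) (λ j → ε ^ toℕ j * r j) (λ j T → det (minor j T))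
        (λ j → map-alternating (select-linear (punchIn j)) (det-cong n) (det-alternating n))))
    where
    alt : ∀ n T r i → toℕ i ≡ 0 → T i ≋ r → det {suc n} (r ∷ᵛ T) ≈ 0#
    alt (suc n) T r zero _ T₀≋r = det-repeated T r T₀≋r

  move-row : ∀ {m n} {F : Matrix (suc m) n → Carrier} → Congruent F → Alternating F →
    ∀ A j → F (A j ∷ᵛ (λ i → A (punchIn j i))) ≈ ε ^ toℕ j * F A
  move-row F-cong F-alt A zero = trans (F-cong (λ { zero j → refl ; (suc i) j → refl })) (sym (*-identityˡ _))
  move-row {suc m} {F = F} F-cong F-alt@(cons _ _ altᵗ) A (suc j) = begin
    F (A (suc j) ∷ᵛ (λ i → A (punchIn (suc j) i)))
      ≈⟨ F-cong (∷-congˡ (λ { zero k → refl ; (suc i) k → refl })) ⟩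
    F (A (suc j) ∷ᵛ A zero ∷ᵛ (λ i → A (suc (punchIn j i))))
      ≈⟨ rows-swap F-cong F-alt _ _ _ ⟩
    ε * F (A zero ∷ᵛ A (suc j) ∷ᵛ (λ i → A (suc (punchIn j i))))
      ≈⟨ *-congˡ (move-row (tail-congruent F-cong (A zero)) (altᵗ (A zero)) (λ i → A (suc i)) j) ⟩
    ε * (ε ^ toℕ j * F (A zero ∷ᵛ (λ i → A (suc i))))
      ≈⟨ *-congˡ (*-congˡ {x = ε ^ toℕ j} (F-cong (∷-η A))) ⟨
    ε * (ε ^ toℕ j * F A)
      ≈⟨ *-assoc ε _ _ ⟨
    (ε * ε ^ toℕ j) * F A ∎

  identity-sum : ∀ n (r : Vector Carrier n) t i → sum (λ k → scalar t i k * r k) ≈ t * r i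
  identity-sum (suc n) r t zero    = trans (+-congˡ (sum-zero n (λ k → zeroˡ (r (suc k))))) (+-identityʳ _)
  identity-sum (suc n) r t (suc i) = trans (+-cong (zeroˡ _) (identity-sum n (λ k → r (suc k)) t i)) (+-identityˡ _)

  sum-identity : ∀ n (r : Vector Carrier n) t j → sum (λ k → r k * scalar t k j) ≈ r j * t
  sum-identity (suc n) r t zero    = trans (+-congˡ (sum-zero n (λ k → zeroʳ (r (suc k))))) (+-identityʳ _)
  sum-identity (suc n) r t (suc j) = trans (+-cong (zeroʳ _) (sum-identity n (λ k → r (suc k)) t j)) (+-identityˡ _)

  ⊠-linear : ∀ {n p} (B : Matrix n p) → Linear (λ r j → sum (λ k → r k * B k j))
  ⊠-linear {n} B = record
    { φ-cong = λ u≋v j → ∑-cong n (λ k → *-congʳ (u≋v k))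
    ; φ-axpy = λ a u v j → begin
        sum (λ k → (a * u k + v k) * B k j)
          ≈⟨ ∑-cong n (λ k → solve 4 (λ a u v b → (a :* u :+ v) :* b := a :* (u :* b) :+ v :* b) refl a (u k) (v k) (B k j)) ⟩
        sum (λ k → a * (u k * B k j) + v k * B k j)
          ≈⟨ ∑-distrib-+ {n} (λ k → a * (u k * B k j)) (λ k → v k * B k j) ⟩
        sum (λ k → a * (u k * B k j)) + sum (λ k → v k * B k j)
          ≈⟨ +-congʳ (*-distribˡ-sum {n} a (λ k → u k * B k j)) ⟨
        a * sum (λ k → u k * B k j) + sum (λ k → v k * B k j) ∎
    }

  -- The first row is expanded in unit rows. Below the unit row `e j`, column j can be cleared, and
  -- what remains is an alternating form of the minor, covered by induction. Its value at the
  -- identity is that of `F` on the identity with row j moved to the top, whence the cofactor sign.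
  alternating-unique : ∀ {n} {F : Matrix n n → Carrier} → Congruent F → Alternating F →
    ∀ A → F A ≈ det A * F (scalar 1#)
  alternating-unique {zero}  F-cong nil A = trans (F-cong (λ ())) (sym (*-identityˡ _))
  alternating-unique {suc n} {F} F-cong F-alt@(cons lin _ altᵗ) A = begin
    F A
      ≈⟨ F-cong (∷-η A) ⟩
    F (A zero ∷ᵛ T)
      ≈⟨ linear-expand (λ r → F (r ∷ᵛ T)) (λ u≋v → F-cong (∷-congʳ u≋v)) (lin T) (A zero) ⟩
    sum (λ j → A zero j * F (e j ∷ᵛ T))
      ≈⟨ ∑-cong (suc n) (λ j → trans (*-congˡ (cofactor j))
           (solve 4 (λ a d p f → a :* (d :* (p :* f)) := (p :* (a :* d)) :* f) refl (A zero j) (det (minor j T)) (ε ^ toℕ j) (F e))) ⟩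
    sum (λ j → (ε ^ toℕ j * (A zero j * det (minor j T))) * F e)
      ≈⟨ *-distribʳ-sum {suc n} (F e) (λ j → ε ^ toℕ j * (A zero j * det (minor j T))) ⟨
    det A * F e ∎
    where
    e : Matrix (suc n) (suc n)
    e = scalar 1#
    T : Matrix n (suc n)
    T i = A (suc i)
    E : Fin (suc n) → Matrix n (suc n)
    E j b = e (punchIn j b)
    -- `φ j` inserts a 0 at position j. It is written as multiplication by the identity without its
    -- row j so that `⊠-linear` applies.
    φ : Fin (suc n) → Vector Carrier n → Vector Carrier (suc n)
    φ j r k = sum (λ b → r b * E j b k)
    decompose : ∀ j i k → T i k ≈ T i j * e j k + φ j (minor j T i) k
    decompose j i k = begin
      T i k                                     ≈⟨ *-identityʳ _ ⟨
      T i k * 1#                                ≈⟨ sum-identity (suc n) (T i) 1# k ⟨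
      sum (λ k′ → T i k′ * e k′ k)              ≈⟨ sum-remove {n} {j} (λ k′ → T i k′ * e k′ k) ⟩
      T i j * e j k + φ j (minor j T i) k       ∎
    cofactor : ∀ j → F (e j ∷ᵛ T) ≈ det (minor j T) * (ε ^ toℕ j * F e)
    cofactor j = begin
      F (e j ∷ᵛ T)
        ≈⟨ F-cong (∷-congˡ (decompose j)) ⟩
      F (e j ∷ᵛ (λ i → axpy (T i j) (e j) (φ j (minor j T i))))
        ≈⟨ add-multiples (tail-congruent F-cong (e j)) (altᵗ (e j)) (e j)
             (λ U i → repeated-row F-cong F-alt (e j) U i) (λ i → T i j) _ ⟩
      F (e j ∷ᵛ (λ i → φ j (minor j T i)))
        ≈⟨ alternating-unique (map-congruent (⊠-linear (E j)) (tail-congruent F-cong (e j)))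
             (map-alternating (⊠-linear (E j)) (tail-congruent F-cong (e j)) (altᵗ (e j))) (minor j T) ⟩
      det (minor j T) * F (e j ∷ᵛ (λ i → φ j (scalar 1# i)))
        ≈⟨ *-congˡ (F-cong (∷-congˡ (λ i k → trans (identity-sum n (λ b → E j b k) 1# i) (*-identityˡ _)))) ⟩
      det (minor j T) * F (e j ∷ᵛ (λ i → e (punchIn j i)))
        ≈⟨ *-congˡ (move-row F-cong F-alt e j) ⟩
      det (minor j T) * (ε ^ toℕ j * F e) ∎

  -- For fixed `B` the left side is an alternating form in the rows of `A` whose value at the
  -- identity is `det B`.
  det-⊠ : ∀ {n} (A B : Matrix n n) → det (A ⊠ B) ≈ det A * det B
  det-⊠ {n} A B = trans
    (alternating-unique (map-congruent (⊠-linear B) (det-cong n))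
      (map-alternating (⊠-linear B) (det-cong n) (det-alternating n)) A)
    (*-congˡ (det-cong n (λ i j → trans (identity-sum n (λ k → B k j) 1# i) (*-identityˡ _))))

-- Block matrices and determinants of the form det (t + X).

module CharacteristicDeterminants {c ℓ₁ ℓ₂} (K : HeytingField c ℓ₁ ℓ₂) (_#?_ : Decidable (HeytingField._#_ K)) where

  open OverField K _#?_ using (_^_; Matrix; _⊞_; _⊠_; scalar; det)
  open Determinants K _#?_
  open AlternatingForms K _#?_
  open CommutativeRing R hiding (zero)
  open SemiringSum semiring
  open SemiringSolver commutativeSemiring using (solve; _:=_; _:+_; _:*_)
  open SetoidReasoning setoid

  ⊠-assoc : ∀ {m n p q} (A : Matrix m n) (B : Matrix n p) (C : Matrix p q) → ((A ⊠ B) ⊠ C) ≐ (A ⊠ (B ⊠ C))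
  ⊠-assoc {n = n} {p} A B C i j = begin
    sum (λ k → sum (λ l → A i l * B l k) * C k j)
      ≈⟨ ∑-cong p (λ k → *-distribʳ-sum {n} (C k j) (λ l → A i l * B l k)) ⟩
    sum (λ k → sum (λ l → (A i l * B l k) * C k j))
      ≈⟨ ∑-comm {p} {n} (λ k l → (A i l * B l k) * C k j) ⟩
    sum (λ l → sum (λ k → (A i l * B l k) * C k j))
      ≈⟨ ∑-cong n (λ l → trans (∑-cong p (λ k → *-assoc (A i l) (B l k) (C k j)))
           (sym (*-distribˡ-sum {p} (A i l) (λ k → B l k * C k j)))) ⟩
    sum (λ l → A i l * sum (λ k → B l k * C k j)) ∎

  det-scale : ∀ n t (A : Matrix n n) → det (λ i j → t * A i j) ≈ t ^ n * det A
  det-scale zero    t A = sym (*-identityˡ 1#)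
  det-scale (suc n) t A = begin
    sum (λ j → ε ^ toℕ j * ((t * A zero j) * det (λ a b → t * minor j T a b)))
      ≈⟨ ∑-cong (suc n) (λ j → trans (*-congˡ {x = ε ^ toℕ j} (*-congˡ (det-scale n t (minor j T))))
           (solve 5 (λ e t a q d → e :* ((t :* a) :* (q :* d)) := (t :* q) :* (e :* (a :* d)))
             refl (ε ^ toℕ j) t (A zero j) (t ^ n) (det (minor j T)))) ⟩
    sum (λ j → (t * t ^ n) * (ε ^ toℕ j * (A zero j * det (minor j T))))
      ≈⟨ *-distribˡ-sum {suc n} (t * t ^ n) (λ j → ε ^ toℕ j * (A zero j * det (minor j T))) ⟨
    (t * t ^ n) * det A ∎
    where
    T : Matrix n (suc n)
    T i = A (suc i)

  mutual
    det-zero-column : ∀ n (A : Matrix (suc n) (suc n)) → (∀ i → A i zero ≈ 0#) → det A ≈ 0#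
    det-zero-column n A A₀≈0 = trans (det-first-column n A (λ i → A₀≈0 (suc i)))
      (trans (*-congʳ (A₀≈0 zero)) (zeroˡ _))

    -- In the expansion along the first row, every minor that deletes a later column keeps the first
    -- one, which is zero below the corner. The induction on size therefore alternates with
    -- `det-zero-column`.
    det-first-column : ∀ n (A : Matrix (suc n) (suc n)) → (∀ i → A (suc i) zero ≈ 0#) →
      det A ≈ A zero zero * det (λ a b → A (suc a) (suc b))
    det-first-column n A A₀≈0 = trans
      (+-cong (*-identityˡ _) (sum-zero n (λ j → trans
        (*-congˡ (trans (*-congˡ (det-minor n (λ a → A (suc a)) j A₀≈0)) (zeroʳ _))) (zeroʳ _))))
      (+-identityʳ _)

    det-minor : ∀ n (T : Matrix n (suc n)) j → (∀ a → T a zero ≈ 0#) → det (minor (suc j) T) ≈ 0#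
    det-minor (suc n) T j T₀≈0 = det-zero-column n (minor (suc j) T) T₀≈0

  1^n≈1 : ∀ n → 1# ^ n ≈ 1#
  1^n≈1 zero    = refl
  1^n≈1 (suc n) = trans (*-identityˡ _) (1^n≈1 n)

  det-scalar : ∀ n t → det {n} (scalar t) ≈ t ^ n
  det-scalar zero    t = refl
  det-scalar (suc n) t = trans (det-first-column n (scalar t) (λ i → refl)) (*-congˡ (det-scalar n t))

  ↑-elim : ∀ m {n} {p} (P : Fin (m ℕ.+ n) → Set p) →
    (∀ i → P (i ↑ˡ n)) → (∀ i → P (m ↑ʳ i)) → ∀ i → P i
  ↑-elim zero    P l r i       = r i
  ↑-elim (suc m) P l r zero    = l zero
  ↑-elim (suc m) P l r (suc i) = ↑-elim m (λ i → P (suc i)) (λ i → l (suc i)) r i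

  -- Columns of the right block contribute nothing to the expansion along the first row, and
  -- deleting a left column leaves a matrix of the same shape with the same lower right block.
  det-block-lower : ∀ m n (X : Matrix (m ℕ.+ n) (m ℕ.+ n)) → (∀ i j → X (i ↑ˡ n) (m ↑ʳ j) ≈ 0#) →
    det X ≈ det (λ i j → X (i ↑ˡ n) (j ↑ˡ n)) * det (λ i j → X (m ↑ʳ i) (m ↑ʳ j))
  det-block-lower zero    n X X≈0 = sym (*-identityˡ _)
  det-block-lower (suc m) n X X≈0 = begin
    det X
      ≈⟨ sum-++ (suc m) (λ j → ε ^ toℕ j * (X zero j * det (minor j T))) ⟩
    sum (λ j → ε ^ toℕ (j ↑ˡ n) * (X zero (j ↑ˡ n) * det (minor (j ↑ˡ n) T))) +
    sum (λ j → ε ^ toℕ (suc m ↑ʳ j) * (X zero (suc m ↑ʳ j) * det (minor (suc m ↑ʳ j) T)))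
      ≈⟨ +-cong (∑-cong (suc m) term) (sum-zero n (λ j →
           trans (*-congˡ (trans (*-congʳ (X≈0 zero j)) (zeroˡ _))) (zeroʳ _))) ⟩
    sum (λ j → (ε ^ toℕ j * (X zero (j ↑ˡ n) * det (minor j T₁))) * det X₂) + 0#
      ≈⟨ +-identityʳ _ ⟩
    sum (λ j → (ε ^ toℕ j * (X zero (j ↑ˡ n) * det (minor j T₁))) * det X₂)
      ≈⟨ *-distribʳ-sum {suc m} (det X₂) (λ j → ε ^ toℕ j * (X zero (j ↑ˡ n) * det (minor j T₁))) ⟨
    det (λ i j → X (i ↑ˡ n) (j ↑ˡ n)) * det X₂ ∎
    where
    T : Matrix (m ℕ.+ n) (suc m ℕ.+ n)
    T i = X (suc i)
    T₁ : Matrix m (suc m)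
    T₁ i j = T (i ↑ˡ n) (j ↑ˡ n)
    X₂ : Matrix n n
    X₂ i j = X (suc m ↑ʳ i) (suc m ↑ʳ j)
    term : ∀ j → ε ^ toℕ (j ↑ˡ n) * (X zero (j ↑ˡ n) * det (minor (j ↑ˡ n) T))
      ≈ (ε ^ toℕ j * (X zero (j ↑ˡ n) * det (minor j T₁))) * det X₂
    term j = begin
      ε ^ toℕ (j ↑ˡ n) * (X zero (j ↑ˡ n) * det (minor (j ↑ˡ n) T))
        ≈⟨ *-cong (reflexive (≡.cong (ε ^_) (Fin.toℕ-↑ˡ j n))) (*-congˡ (trans
             (det-block-lower m n (minor (j ↑ˡ n) T) (λ a b →
               trans (reflexive (≡.cong (T (a ↑ˡ n)) (punchIn-↑ˡ-↑ʳ j b))) (X≈0 (suc a) b)))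
             (*-cong
               (det-cong m (λ a b → reflexive (≡.cong (T (a ↑ˡ n)) (punchIn-↑ˡ-↑ˡ n j b))))
               (det-cong n (λ a b → reflexive (≡.cong (T (m ↑ʳ a)) (punchIn-↑ˡ-↑ʳ j b))))))) ⟩
      ε ^ toℕ j * (X zero (j ↑ˡ n) * (det (minor j T₁) * det X₂))
        ≈⟨ solve 4 (λ e x d f → e :* (x :* (d :* f)) := (e :* (x :* d)) :* f) refl (ε ^ toℕ j) (X zero (j ↑ˡ n)) (det (minor j T₁)) (det X₂) ⟩
      (ε ^ toℕ j * (X zero (j ↑ˡ n) * det (minor j T₁))) * det X₂ ∎

  -- Here the zeros lie in columns, so the first column is peeled off instead; the identity block
  -- makes each corner entry 1.
  det-block-upper : ∀ m n (X : Matrix (m ℕ.+ n) (m ℕ.+ n)) →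
    (∀ i j → X (i ↑ˡ n) (j ↑ˡ n) ≈ scalar 1# i j) → (∀ i j → X (m ↑ʳ i) (j ↑ˡ n) ≈ 0#) →
    det X ≈ det (λ i j → X (m ↑ʳ i) (m ↑ʳ j))
  det-block-upper zero    n X X≈1 X≈0 = refl
  det-block-upper (suc m) n X X≈1 X≈0 = begin
    det X
      ≈⟨ det-first-column (m ℕ.+ n) X (↑-elim m (λ i → X (suc i) zero ≈ 0#) (λ i → X≈1 (suc i) zero) (λ i → X≈0 i zero)) ⟩
    X zero zero * det (λ a b → X (suc a) (suc b))
      ≈⟨ *-cong (X≈1 zero zero) (det-block-upper m n (λ a b → X (suc a) (suc b))
           (λ i j → X≈1 (suc i) (suc j)) (λ i j → X≈0 i (suc j))) ⟩
    1# * det (λ i j → X (suc m ↑ʳ i) (suc m ↑ʳ j))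
      ≈⟨ *-identityˡ _ ⟩
    det (λ i j → X (suc m ↑ʳ i) (suc m ↑ʳ j)) ∎

  module _ {m n : ℕ} where

    block : Matrix m m → Matrix m n → Matrix n m → Matrix n n → Matrix (m ℕ.+ n) (m ℕ.+ n)
    block A B C D = (λ i → A i ++ B i) ++ (λ i → C i ++ D i)

    module _ (A : Matrix m m) (B : Matrix m n) (C : Matrix n m) (D : Matrix n n) where

      private
        topRow : ∀ i → block A B C D (i ↑ˡ n) ≡ A i ++ B i
        topRow = lookup-++ˡ (λ i → A i ++ B i) (λ i → C i ++ D i)
        bottomRow : ∀ i → block A B C D (m ↑ʳ i) ≡ C i ++ D i
        bottomRow = lookup-++ʳ (λ i → A i ++ B i) (λ i → C i ++ D i)

      block₁₁ : ∀ i j → block A B C D (i ↑ˡ n) (j ↑ˡ n) ≡ A i j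
      block₁₁ i j = ≡.trans (≡.cong (λ r → r (j ↑ˡ n)) (topRow i)) (lookup-++ˡ (A i) (B i) j)
      block₁₂ : ∀ i j → block A B C D (i ↑ˡ n) (m ↑ʳ j) ≡ B i j
      block₁₂ i j = ≡.trans (≡.cong (λ r → r (m ↑ʳ j)) (topRow i)) (lookup-++ʳ (A i) (B i) j)
      block₂₁ : ∀ i j → block A B C D (m ↑ʳ i) (j ↑ˡ n) ≡ C i j
      block₂₁ i j = ≡.trans (≡.cong (λ r → r (j ↑ˡ n)) (bottomRow i)) (lookup-++ˡ (C i) (D i) j)
      block₂₂ : ∀ i j → block A B C D (m ↑ʳ i) (m ↑ʳ j) ≡ D i j
      block₂₂ i j = ≡.trans (≡.cong (λ r → r (m ↑ʳ j)) (bottomRow i)) (lookup-++ʳ (C i) (D i) j)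

    module _ (A : Matrix m m) (B : Matrix m n) (C : Matrix n m) (D : Matrix n n)
             (A′ : Matrix m m) (B′ : Matrix m n) (C′ : Matrix n m) (D′ : Matrix n n) where

      private
        X Y : Matrix (m ℕ.+ n) (m ℕ.+ n)
        X = block A B C D
        Y = block A′ B′ C′ D′

        entry : ∀ {i j} {u u′ : Vector Carrier m} {v v′ : Vector Carrier n} →
          (∀ k → X i (k ↑ˡ n) ≡ u k) → (∀ k → Y (k ↑ˡ n) j ≡ u′ k) →
          (∀ k → X i (m ↑ʳ k) ≡ v k) → (∀ k → Y (m ↑ʳ k) j ≡ v′ k) →
          (X ⊠ Y) i j ≈ sum (λ k → u k * u′ k) + sum (λ k → v k * v′ k)
        entry {i} {j} p p′ q q′ = trans (sum-++ m (λ k → X i k * Y k j))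
          (+-cong (∑-cong m (λ k → reflexive (≡.cong₂ _*_ (p k) (p′ k))))
                  (∑-cong n (λ k → reflexive (≡.cong₂ _*_ (q k) (q′ k)))))

      block-⊠₁₁ : ∀ i j → (X ⊠ Y) (i ↑ˡ n) (j ↑ˡ n) ≈ ((A ⊠ A′) ⊞ (B ⊠ C′)) i j
      block-⊠₁₁ i j = entry (block₁₁ A B C D i) (λ k → block₁₁ A′ B′ C′ D′ k j) (block₁₂ A B C D i) (λ k → block₂₁ A′ B′ C′ D′ k j)
      block-⊠₁₂ : ∀ i j → (X ⊠ Y) (i ↑ˡ n) (m ↑ʳ j) ≈ ((A ⊠ B′) ⊞ (B ⊠ D′)) i j
      block-⊠₁₂ i j = entry (block₁₁ A B C D i) (λ k → block₁₂ A′ B′ C′ D′ k j) (block₁₂ A B C D i) (λ k → block₂₂ A′ B′ C′ D′ k j)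
      block-⊠₂₂ : ∀ i j → (X ⊠ Y) (m ↑ʳ i) (m ↑ʳ j) ≈ ((C ⊠ B′) ⊞ (D ⊠ D′)) i j
      block-⊠₂₂ i j = entry (block₂₁ A B C D i) (λ k → block₁₂ A′ B′ C′ D′ k j) (block₂₂ A B C D i) (λ k → block₂₂ A′ B′ C′ D′ k j)

  -- With P = [[t, −B], [A, 1]], both [[1, B], [0, 1]] P and P [[1, B], [0, t]]
  -- are block lower triangular.
  det-exchange : ∀ {m n} (A : Matrix n m) (B : Matrix m n) t →
    t ^ n * det (scalar t ⊞ (B ⊠ A)) ≈ t ^ m * det (scalar t ⊞ (A ⊠ B))
  det-exchange {m} {n} A B t = begin
    t ^ n * det (scalar t ⊞ (B ⊠ A))          ≈⟨ *-congˡ UP ⟨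
    t ^ n * det P                             ≈⟨ *-comm _ _ ⟩
    det P * t ^ n                             ≈⟨ PV ⟩
    t ^ m * det (scalar t ⊞ (A ⊠ B))          ∎
    where
    B⁻ : Matrix m n
    B⁻ i j = ε * B i j
    O : Matrix n m
    O i j = 0#
    P U V : Matrix (m ℕ.+ n) (m ℕ.+ n)
    P = block (scalar t) B⁻ A (scalar 1#)
    U = block (scalar 1#) B O (scalar 1#)
    V = block (scalar 1#) B O (scalar t)
    det-unitriangular : ∀ s → det (block (scalar 1#) B O (scalar s)) ≈ s ^ n
    det-unitriangular s = trans
      (det-block-upper m n (block (scalar 1#) B O (scalar s))
        (λ i j → reflexive (block₁₁ (scalar 1#) B O (scalar s) i j))
        (λ i j → reflexive (block₂₁ (scalar 1#) B O (scalar s) i j)))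
      (trans (det-cong n (λ i j → reflexive (block₂₂ (scalar 1#) B O (scalar s) i j))) (det-scalar n s))
    UP : det P ≈ det (scalar t ⊞ (B ⊠ A))
    UP = begin
      det P
        ≈⟨ *-identityˡ _ ⟨
      1# * det P
        ≈⟨ *-congʳ (trans (det-unitriangular 1#) (1^n≈1 n)) ⟨
      det U * det P
        ≈⟨ det-⊠ U P ⟨
      det (U ⊠ P)
        ≈⟨ det-block-lower m n (U ⊠ P) (λ i j → trans
             (block-⊠₁₂ (scalar 1#) B O (scalar 1#) (scalar t) B⁻ A (scalar 1#) i j)
             (trans (+-cong (trans (identity-sum m (λ k → B⁻ k j) 1# i) (*-identityˡ _))
                            (trans (sum-identity n (B i) 1# j) (*-identityʳ _)))
                    (ε*x+x≈0 (B i j)))) ⟩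
      det (λ i j → (U ⊠ P) (i ↑ˡ n) (j ↑ˡ n)) * det (λ i j → (U ⊠ P) (m ↑ʳ i) (m ↑ʳ j))
        ≈⟨ *-cong
             (det-cong m (λ i j → trans (block-⊠₁₁ (scalar 1#) B O (scalar 1#) (scalar t) B⁻ A (scalar 1#) i j)
               (+-congʳ (trans (identity-sum m (λ k → scalar t k j) 1# i) (*-identityˡ _)))))
             (trans (det-cong n (λ i j → trans (block-⊠₂₂ (scalar 1#) B O (scalar 1#) (scalar t) B⁻ A (scalar 1#) i j)
               (trans (+-cong (sum-zero m (λ k → zeroˡ _)) (trans (identity-sum n (λ k → scalar 1# k j) 1# i) (*-identityˡ _)))
                      (+-identityˡ _))))
               (trans (det-scalar n 1#) (1^n≈1 n))) ⟩
      det (scalar t ⊞ (B ⊠ A)) * 1#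
        ≈⟨ *-identityʳ _ ⟩
      det (scalar t ⊞ (B ⊠ A)) ∎
    PV : det P * t ^ n ≈ t ^ m * det (scalar t ⊞ (A ⊠ B))
    PV = begin
      det P * t ^ n
        ≈⟨ *-congˡ (det-unitriangular t) ⟨
      det P * det V
        ≈⟨ det-⊠ P V ⟨
      det (P ⊠ V)
        ≈⟨ det-block-lower m n (P ⊠ V) (λ i j → trans
             (block-⊠₁₂ (scalar t) B⁻ A (scalar 1#) (scalar 1#) B O (scalar t) i j)
             (trans (+-cong (identity-sum m (λ k → B k j) t i) (sum-identity n (B⁻ i) t j))
               (trans (solve 3 (λ t b e → t :* b :+ (e :* b) :* t := e :* (t :* b) :+ t :* b) refl t (B i j) ε)
                      (ε*x+x≈0 (t * B i j))))) ⟩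
      det (λ i j → (P ⊠ V) (i ↑ˡ n) (j ↑ˡ n)) * det (λ i j → (P ⊠ V) (m ↑ʳ i) (m ↑ʳ j))
        ≈⟨ *-cong
             (trans (det-cong m (λ i j → trans (block-⊠₁₁ (scalar t) B⁻ A (scalar 1#) (scalar 1#) B O (scalar t) i j)
               (trans (+-cong (trans (sum-identity m (scalar t i) 1# j) (*-identityʳ _)) (sum-zero n (λ k → zeroʳ _)))
                      (+-identityʳ _))))
               (det-scalar m t))
             (det-cong n (λ i j → trans (block-⊠₂₂ (scalar t) B⁻ A (scalar 1#) (scalar 1#) B O (scalar t) i j)
               (trans (+-congˡ (trans (identity-sum n (λ k → scalar t k j) 1# i) (*-identityˡ _))) (+-comm _ _)))) ⟩
      t ^ m * det (scalar t ⊞ (A ⊠ B)) ∎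

  -- Since XY = 0, the product (t + X)(t + Y) is t (t + X + Y), and its determinant releases one
  -- factor t per row.
  det-⊞-orthogonal : ∀ {n} (X Y : Matrix n n) → (∀ i j → (X ⊠ Y) i j ≈ 0#) → ∀ t →
    det (scalar t ⊞ X) * det (scalar t ⊞ Y) ≈ t ^ n * det (scalar t ⊞ (X ⊞ Y))
  det-⊞-orthogonal {n} X Y XY≈0 t = begin
    det (scalar t ⊞ X) * det (scalar t ⊞ Y)
      ≈⟨ det-⊠ (scalar t ⊞ X) (scalar t ⊞ Y) ⟨
    det ((scalar t ⊞ X) ⊠ (scalar t ⊞ Y))
      ≈⟨ det-cong n expand ⟩
    det (λ i j → t * (scalar t ⊞ (X ⊞ Y)) i j)
      ≈⟨ det-scale n t (scalar t ⊞ (X ⊞ Y)) ⟩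
    t ^ n * det (scalar t ⊞ (X ⊞ Y)) ∎
    where
    expand : ∀ i j → ((scalar t ⊞ X) ⊠ (scalar t ⊞ Y)) i j ≈ t * (scalar t i j + (X i j + Y i j))
    expand i j = begin
      sum (λ k → (scalar t i k + X i k) * (scalar t k j + Y k j))
        ≈⟨ ∑-cong n (λ k → solve 4 (λ s x u y → (s :+ x) :* (u :+ y) := s :* (u :+ y) :+ (x :* u :+ x :* y)) refl
             (scalar t i k) (X i k) (scalar t k j) (Y k j)) ⟩
      sum (λ k → scalar t i k * (scalar t k j + Y k j) + (X i k * scalar t k j + X i k * Y k j))
        ≈⟨ ∑-distrib-+ {n} (λ k → scalar t i k * (scalar t k j + Y k j)) (λ k → X i k * scalar t k j + X i k * Y k j) ⟩
      sum (λ k → scalar t i k * (scalar t k j + Y k j)) + sum (λ k → X i k * scalar t k j + X i k * Y k j)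
        ≈⟨ +-cong (identity-sum n (λ k → scalar t k j + Y k j) t i)
             (trans (∑-distrib-+ {n} (λ k → X i k * scalar t k j) (λ k → X i k * Y k j))
               (+-cong (sum-identity n (X i) t j) (XY≈0 i j))) ⟩
      t * (scalar t i j + Y i j) + (X i j * t + 0#)
        ≈⟨ +-congˡ (+-identityʳ _) ⟩
      t * (scalar t i j + Y i j) + X i j * t
        ≈⟨ solve 4 (λ t s x y → t :* (s :+ y) :+ x :* t := t :* (s :+ (x :+ y))) refl t (scalar t i j) (X i j) (Y i j) ⟩
      t * (scalar t i j + (X i j + Y i j)) ∎

-- Polynomial functions, their lowest coefficients, and pseudo determinants.

module PseudoDeterminants {c ℓ₁ ℓ₂} (K : HeytingField c ℓ₁ ℓ₂) (_#?_ : Decidable (HeytingField._#_ K))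
  (charZero : OverField.CharZero K _#?_) where

  open OverField K _#?_ using (_^_; _·_; product; Matrix; _⊞_; _⊠_; scalar; det; Eigenvalues; Det)
  open Determinants K _#?_
  open AlternatingForms K _#?_ using (det-cong)
  open CharacteristicDeterminants K _#?_
  open HeytingField K using (_#_; #⇒invertible; invertible⇒#; tight)
  open CommutativeRing R hiding (zero)
  open RingProperties ring using (-1*x≈-x; -0#≈0#; -‿involutive; -‿+-comm; +-cancelˡ)
  open SemiringSum semiring
  open SemiringExp semiring using (^-homo-*)
  open SemiringSolver commutativeSemiring using (solve; _:=_; _:+_; _:*_)
  open SetoidReasoning setoid

  -- Apartness in a Heyting field means invertibility of the difference, so `x # 0#` provides an
  -- inverse of `x - 0#`.
  x-0≈x : ∀ x → x - 0# ≈ x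
  x-0≈x x = trans (+-congˡ -0#≈0#) (+-identityʳ x)

  x#0⇒inverse : ∀ {x} → x # 0# → ∃ λ y → y * x ≈ 1#
  x#0⇒inverse x#0 with #⇒invertible x#0
  ... | y , y*x≈1 , _ = y , trans (*-congˡ (sym (x-0≈x _))) y*x≈1

  inverse⇒x#0 : ∀ {x y} → y * x ≈ 1# → x # 0#
  inverse⇒x#0 {x} {y} y*x≈1 = invertible⇒# (y , left , trans (*-comm _ _) left)
    where
    left : y * (x - 0#) ≈ 1#
    left = trans (*-congˡ (x-0≈x x)) y*x≈1

  1#0 : 1# # 0#
  1#0 = inverse⇒x#0 (*-identityˡ 1#)

  x#0⇒x≉0 : ∀ {x} → x # 0# → ¬ (x ≈ 0#)
  x#0⇒x≉0 {x} x#0 x≈0 = proj₂ (tight x 0#) x≈0 x#0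

  #0-resp-≈ : ∀ {x y} → x ≈ y → x # 0# → y # 0#
  #0-resp-≈ x≈y x#0 with x#0⇒inverse x#0
  ... | z , z*x≈1 = inverse⇒x#0 (trans (*-congˡ (sym x≈y)) z*x≈1)

  *-#0 : ∀ {x y} → x # 0# → y # 0# → x * y # 0#
  *-#0 {x} {y} x#0 y#0 with x#0⇒inverse x#0 | x#0⇒inverse y#0
  ... | x′ , x′*x≈1 | y′ , y′*y≈1 = inverse⇒x#0 (begin
    (x′ * y′) * (x * y)   ≈⟨ solve 4 (λ x′ y′ x y → (x′ :* y′) :* (x :* y) := (x′ :* x) :* (y′ :* y)) refl x′ y′ x y ⟩
    (x′ * x) * (y′ * y)   ≈⟨ *-cong x′*x≈1 y′*y≈1 ⟩
    1# * 1#               ≈⟨ *-identityˡ 1# ⟩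
    1#                    ∎)

  *-cancelˡ-#0 : ∀ {x y z} → x # 0# → x * y ≈ x * z → y ≈ z
  *-cancelˡ-#0 {x} {y} {z} x#0 x*y≈x*z with x#0⇒inverse x#0
  ... | x′ , x′*x≈1 = begin
    y              ≈⟨ *-identityˡ y ⟨
    1# * y         ≈⟨ *-congʳ x′*x≈1 ⟨
    (x′ * x) * y   ≈⟨ *-assoc x′ x y ⟩
    x′ * (x * y)   ≈⟨ *-congˡ x*y≈x*z ⟩
    x′ * (x * z)   ≈⟨ *-assoc x′ x z ⟨
    (x′ * x) * z   ≈⟨ *-congʳ x′*x≈1 ⟩
    1# * z         ≈⟨ *-identityˡ z ⟩
    z              ∎

  -- Polynomial functions of degree less than n, characterised by their
  -- difference quotients instead of by coefficients.
  Poly : ℕ → (Carrier → Carrier) → Set (c ⊔ ℓ₁)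
  Poly zero    f = ∀ t → f t ≈ 0#
  Poly (suc n) f = ∀ a → ∃ λ q → Poly n q × (∀ {t} s → t ≈ a + s → f t ≈ f a + s * q s)

  poly-cong : ∀ n {f g} → (∀ t → f t ≈ g t) → Poly n f → Poly n g
  poly-cong zero    f≈g f≈0 t = trans (sym (f≈g t)) (f≈0 t)
  poly-cong (suc n) f≈g p a with p a
  ... | q , Q , f-eq = q , Q , λ s t≈a+s → trans (sym (f≈g _)) (trans (f-eq s t≈a+s) (+-congʳ (f≈g a)))

  poly-suc : ∀ n {f} → Poly n f → Poly (suc n) f
  poly-suc zero    {f} f≈0 a = (λ _ → 0#) , (λ _ → refl) , λ {t} s _ → begin
    f t              ≈⟨ f≈0 t ⟩
    0#               ≈⟨ +-identityˡ 0# ⟨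
    0# + 0#          ≈⟨ +-cong (f≈0 a) (zeroʳ s) ⟨
    f a + s * 0#     ∎
  poly-suc (suc n) p a with p a
  ... | q , Q , f-eq = q , poly-suc n Q , f-eq

  poly-+ˡ : ∀ m {n f} → Poly n f → Poly (m ℕ.+ n) f
  poly-+ˡ zero            p = p
  poly-+ˡ (suc m) {n} {f} p = poly-suc (m ℕ.+ n) (poly-+ˡ m {n} {f} p)

  poly-constant : ∀ k → Poly 1 (λ _ → k)
  poly-constant k a = (λ _ → 0#) , (λ _ → refl) , λ s _ → sym (trans (+-congˡ (zeroʳ s)) (+-identityʳ k))

  poly-translate : ∀ n k {f} → Poly (suc n) f → Poly (suc n) (λ t → k + f t)
  poly-translate n k p a with p a
  ... | q , Q , f-eq = q , Q , λ s t≈a+s → trans (+-congˡ (f-eq s t≈a+s)) (sym (+-assoc _ _ _))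

  -- The shift `b` is arbitrary because recentring at `a` turns the factor t + b into s + (a + b):
  -- the difference quotient is a constant plus a product of the same kind, one degree lower.
  poly-linear : ∀ n b {f} → Poly n f → Poly (suc n) (λ t → (t + b) * f t)
  poly-linear zero    b {f} f≈0 a = (λ _ → 0#) , (λ _ → refl) , λ {t} s _ → begin
    (t + b) * f t              ≈⟨ trans (*-congˡ (f≈0 t)) (zeroʳ _) ⟩
    0#                         ≈⟨ +-identityˡ 0# ⟨
    0# + 0#                    ≈⟨ +-cong (trans (*-congˡ (f≈0 a)) (zeroʳ _)) (zeroʳ s) ⟨
    (a + b) * f a + s * 0#     ∎
  poly-linear (suc n) b {f} p a with p a
  ... | q , Q , f-eq = (λ s → f a + (s + (a + b)) * q s) , poly-translate n (f a) (poly-linear n (a + b) {q} Q) , λ {t} s t≈a+s → begin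
    (t + b) * f t
      ≈⟨ *-cong (+-congʳ t≈a+s) (f-eq s t≈a+s) ⟩
    ((a + s) + b) * (f a + s * q s)
      ≈⟨ solve 5 (λ a b s x y → ((a :+ s) :+ b) :* (x :+ s :* y) := (a :+ b) :* x :+ s :* (x :+ (s :+ (a :+ b)) :* y)) refl a b s (f a) (q s) ⟩
    (a + b) * f a + s * (f a + (s + (a + b)) * q s) ∎

  poly-power : ∀ n a {f} → Poly n f → Poly (a ℕ.+ n) (λ t → t ^ a * f t)
  poly-power n zero    p = poly-cong n (λ t → sym (*-identityˡ _)) p
  poly-power n (suc a) {f} p = poly-cong (suc (a ℕ.+ n)) {λ t → (t + 0#) * (t ^ a * f t)}
    (λ t → trans (*-congʳ (+-identityʳ t)) (sym (*-assoc t (t ^ a) (f t))))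
    (poly-linear (a ℕ.+ n) 0# {λ t → t ^ a * f t} (poly-power n a {f} p))

  -- Centred at 1, the difference quotients of `f` and `g` agree at s = 1, 2, 3, ..., because the
  -- functions agree at 1 + s and s can be cancelled. The hypothesis thus reproduces itself one
  -- degree lower, and no roots are counted.
  poly-agree : ∀ n {f g} → Poly n f → Poly n g →
    (∀ j → f (suc j · 1#) ≈ g (suc j · 1#)) → ∀ t → f t ≈ g t
  poly-agree zero    f≈0 g≈0 f≈g t = trans (f≈0 t) (sym (g≈0 t))
  poly-agree (suc n) {f} {g} p p′ f≈g t with p (1 · 1#) | p′ (1 · 1#)
  ... | q , Q , f-eq | q′ , Q′ , g-eq = begin
    f t                        ≈⟨ f-eq (t - a) t≈a+[t-a] ⟩
    f a + (t - a) * q (t - a)  ≈⟨ +-cong (f≈g 0) (*-congˡ (poly-agree n {q} {q′} Q Q′ q≈q′ (t - a))) ⟩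
    g a + (t - a) * q′ (t - a) ≈⟨ g-eq (t - a) t≈a+[t-a] ⟨
    g t                        ∎
    where
    a : Carrier
    a = 1 · 1#
    t≈a+[t-a] : t ≈ a + (t - a)
    t≈a+[t-a] = sym (trans (solve 3 (λ a t m → a :+ (t :+ m) := t :+ (a :+ m)) refl a t (- a))
      (trans (+-congˡ (-‿inverseʳ a)) (+-identityʳ t)))
    q≈q′ : ∀ j → q (suc j · 1#) ≈ q′ (suc j · 1#)
    q≈q′ j = *-cancelˡ-#0 (charZero j) (+-cancelˡ (f a) _ _ (begin
      f a + s * q s        ≈⟨ f-eq s 1+s ⟨
      f (suc (suc j) · 1#) ≈⟨ f≈g (suc j) ⟩
      g (suc (suc j) · 1#) ≈⟨ g-eq s 1+s ⟩
      g a + s * q′ s       ≈⟨ +-congʳ (f≈g 0) ⟨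
      f a + s * q′ s       ∎))
      where
      s : Carrier
      s = suc j · 1#
      1+s : suc (suc j) · 1# ≈ a + s
      1+s = +-congʳ (sym (+-identityʳ 1#))

  -- At t = 1, 2, 3, ... common powers of t cancel until one exponent is 0. Then `poly-agree`
  -- extends the equation to t = 0, where a power left on the other side would make a non-zero value
  -- vanish.
  lowest-coefficient : ∀ a b {m n f g} → Poly m f → Poly n g → f 0# # 0# → g 0# # 0# →
    (∀ j → (suc j · 1#) ^ a * f (suc j · 1#) ≈ (suc j · 1#) ^ b * g (suc j · 1#)) → f 0# ≈ g 0#
  lowest-coefficient zero b {m} {n} {f} {g} p q f₀#0 g₀#0 f≈g = at-zero b agree
    where
    agree : ∀ t → f t ≈ t ^ b * g t
    agree = poly-agree ((b ℕ.+ n) ℕ.+ m) {f} {λ t → t ^ b * g t} (poly-+ˡ (b ℕ.+ n) {m} {f} p)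
      (≡.subst (λ k → Poly k (λ t → t ^ b * g t)) (ℕ.+-comm m (b ℕ.+ n))
        (poly-+ˡ m {b ℕ.+ n} {λ t → t ^ b * g t} (poly-power n b {g} q)))
      (λ j → trans (sym (*-identityˡ _)) (f≈g j))
    at-zero : ∀ b → (∀ t → f t ≈ t ^ b * g t) → f 0# ≈ g 0#
    at-zero zero    agree = trans (agree 0#) (*-identityˡ _)
    at-zero (suc b) agree = contradiction (trans (agree 0#) (trans (*-congʳ (zeroˡ _)) (zeroˡ _))) (x#0⇒x≉0 f₀#0)
  lowest-coefficient (suc a) zero {m} {n} {f} {g} p q f₀#0 g₀#0 f≈g =
    sym (lowest-coefficient zero (suc a) {n} {m} {g} {f} q p g₀#0 f₀#0 (λ j → sym (f≈g j)))
  lowest-coefficient (suc a) (suc b) {m} {n} {f} {g} p q f₀#0 g₀#0 f≈g =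
    lowest-coefficient a b {m} {n} {f} {g} p q f₀#0 g₀#0 (λ j → *-cancelˡ-#0 (charZero j)
      (trans (sym (*-assoc _ _ _)) (trans (f≈g j) (*-assoc _ _ _))))

  nonzeroFactors : ∀ {n} → Vector Carrier n → Carrier → Carrier
  nonzeroFactors v t = product (λ i → if does (v i #? 0#) then t + v i else 1#)

  factor-zeros : ∀ n (v : Vector Carrier n) →
    ∃ λ z → ∀ t → product (λ i → t + v i) ≈ t ^ z * nonzeroFactors v t
  factor-zeros zero    v = 0 , λ t → sym (*-identityˡ 1#)
  factor-zeros (suc n) v with v zero #? 0# | factor-zeros n (λ i → v (suc i))
  ... | yes _    | z , eq = z , λ t → trans (*-congˡ (eq t))
    (solve 3 (λ x p s → x :* (p :* s) := p :* (x :* s)) refl (t + v zero) (t ^ z) _)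
  ... | no  ¬v#0 | z , eq = suc z , λ t → trans
    (*-cong (trans (+-congˡ (proj₁ (tight (v zero) 0#) ¬v#0)) (+-identityʳ t)) (eq t))
    (trans (sym (*-assoc _ _ _)) (*-congˡ (sym (*-identityˡ _))))

  -- The accumulator `f` lets the lemma be applied twice in succession, which treats a product of
  -- two such polynomials without closure of `Poly` under multiplication.
  nonzeroFactors-poly : ∀ n (v : Vector Carrier n) {m f} → Poly m f →
    ∃ λ k → Poly k (λ t → nonzeroFactors v t * f t)
  nonzeroFactors-poly zero    v {m} p = m , poly-cong m (λ t → sym (*-identityˡ _)) p
  nonzeroFactors-poly (suc n) v {m} {f} p with v zero #? 0# | nonzeroFactors-poly n (λ i → v (suc i)) {m} {f} p
  ... | yes _ | k , q = suc k , poly-cong (suc k) (λ t → sym (*-assoc _ _ _)) (poly-linear k (v zero) q)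
  ... | no  _ | k , q = k , poly-cong k (λ t → *-congʳ (sym (*-identityˡ _))) q

  nonzero-product : ∀ {n} → Vector Carrier n → Carrier
  nonzero-product v = product (λ i → if does (v i #? 0#) then v i else 1#)

  nonzero-product-#0 : ∀ n (v : Vector Carrier n) → nonzero-product v # 0#
  nonzero-product-#0 zero    v = 1#0
  nonzero-product-#0 (suc n) v with v zero #? 0#
  ... | yes v₀#0 = *-#0 v₀#0 (nonzero-product-#0 n (λ i → v (suc i)))
  ... | no  _    = *-#0 1#0 (nonzero-product-#0 n (λ i → v (suc i)))

  nonzeroFactors-0 : ∀ n (v : Vector Carrier n) → nonzeroFactors v 0# ≈ nonzero-product v
  nonzeroFactors-0 zero    v = refl
  nonzeroFactors-0 (suc n) v with v zero #? 0#
  ... | yes _ = *-cong (+-identityˡ _) (nonzeroFactors-0 n (λ i → v (suc i)))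
  ... | no  _ = *-congˡ (nonzeroFactors-0 n (λ i → v (suc i)))

  -- Zero entries are absorbed into powers of t, leaving polynomials that do not vanish at 0 and
  -- whose values there are the pseudo determinants. As `a` and `b` are arbitrary, the zero entries
  -- on the two sides never have to be matched.
  nonzero-product-* : ∀ {l m n} (u : Vector Carrier l) (v : Vector Carrier m) (w : Vector Carrier n) a b →
    (∀ t → t ^ a * product (λ i → t + u i) ≈ t ^ b * (product (λ i → t + v i) * product (λ i → t + w i))) →
    nonzero-product u ≈ nonzero-product v * nonzero-product w
  nonzero-product-* {l} {m} {n} u v w a b eq
    with factor-zeros l u | factor-zeros m v | factor-zeros n w
       | nonzeroFactors-poly l u {1} {λ _ → 1#} (poly-constant 1#)
       | nonzeroFactors-poly n w {1} {λ _ → 1#} (poly-constant 1#)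
  ... | x , u-eq | y , v-eq | z , w-eq | i , p | j , q
    with nonzeroFactors-poly m v {j} {λ t → nonzeroFactors w t * 1#} q
  ... | k , r = begin
    nonzero-product u
      ≈⟨ P-0 ⟨
    P 0#
      ≈⟨ lowest-coefficient (a ℕ.+ x) (b ℕ.+ (y ℕ.+ z)) {i} {k} {P} {Q} p r
           (#0-resp-≈ (sym P-0) (nonzero-product-#0 l u))
           (#0-resp-≈ (sym Q-0) (*-#0 (nonzero-product-#0 m v) (nonzero-product-#0 n w)))
           (λ j → P≈Q (suc j · 1#)) ⟩
    Q 0#
      ≈⟨ Q-0 ⟩
    nonzero-product v * nonzero-product w ∎
    where
    P Q : Carrier → Carrier
    P t = nonzeroFactors u t * 1#
    Q t = nonzeroFactors v t * (nonzeroFactors w t * 1#)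
    P-0 : P 0# ≈ nonzero-product u
    P-0 = trans (*-identityʳ _) (nonzeroFactors-0 l u)
    Q-0 : Q 0# ≈ nonzero-product v * nonzero-product w
    Q-0 = *-cong (nonzeroFactors-0 m v) (trans (*-identityʳ _) (nonzeroFactors-0 n w))
    P≈Q : ∀ t → t ^ (a ℕ.+ x) * P t ≈ t ^ (b ℕ.+ (y ℕ.+ z)) * Q t
    P≈Q t = begin
      t ^ (a ℕ.+ x) * (nonzeroFactors u t * 1#)
        ≈⟨ *-cong (^-homo-* t a x) (*-identityʳ _) ⟩
      (t ^ a * t ^ x) * nonzeroFactors u t
        ≈⟨ trans (*-assoc _ _ _) (*-congˡ (sym (u-eq t))) ⟩
      t ^ a * product (λ i → t + u i)
        ≈⟨ eq t ⟩
      t ^ b * (product (λ i → t + v i) * product (λ i → t + w i))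
        ≈⟨ *-congˡ (*-cong (v-eq t) (w-eq t)) ⟩
      t ^ b * ((t ^ y * nonzeroFactors v t) * (t ^ z * nonzeroFactors w t))
        ≈⟨ solve 5 (λ b y v z w → b :* ((y :* v) :* (z :* w)) := (b :* (y :* z)) :* (v :* w)) refl
             (t ^ b) (t ^ y) (nonzeroFactors v t) (t ^ z) (nonzeroFactors w t) ⟩
      (t ^ b * (t ^ y * t ^ z)) * (nonzeroFactors v t * nonzeroFactors w t)
        ≈⟨ *-cong (trans (^-homo-* t b (y ℕ.+ z)) (*-congˡ (^-homo-* t y z))) (*-congˡ (*-identityʳ _)) ⟨
      t ^ (b ℕ.+ (y ℕ.+ z)) * Q t ∎

  module _ {n : ℕ} {A : Matrix n n} (E : Eigenvalues A) where
    open Eigenvalues E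

    private
      -x-y≈ε*[x+y] : ∀ x y → - x - y ≈ ε * (x + y)
      -x-y≈ε*[x+y] x y = trans (-‿+-comm x y) (sym (-1*x≈-x (x + y)))

      product-scale : ∀ n (u v : Vector Carrier n) s → (∀ i → u i ≈ s * v i) → product u ≈ s ^ n * product v
      product-scale zero    u v s eq = sym (*-identityˡ 1#)
      product-scale (suc n) u v s eq = trans
        (*-cong (eq zero) (product-scale n (λ i → u (suc i)) (λ i → v (suc i)) s (λ i → eq (suc i))))
        (solve 4 (λ s x p q → (s :* x) :* (p :* q) := (s :* p) :* (x :* q)) refl s (v zero) (s ^ n) _)

      ε^-#0 : ∀ n → ε ^ n # 0#
      ε^-#0 zero    = 1#0
      ε^-#0 (suc n) = *-#0 (inverse⇒x#0 {y = ε} (trans (-1*x≈-x ε) (-‿involutive 1#))) (ε^-#0 n)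

    -- The characteristic polynomial is evaluated at -t, and the sign (-1)^n cancels from both
    -- sides. Later identities then involve sums only.
    det-shift : ∀ t → det (scalar t ⊞ A) ≈ product (λ i → t + eigenvalue i)
    det-shift t = *-cancelˡ-#0 (ε^-#0 n) (begin
      ε ^ n * det (scalar t ⊞ A)
        ≈⟨ det-scale n ε (scalar t ⊞ A) ⟨
      det (λ i j → ε * (scalar t i j + A i j))
        ≈⟨ det-cong n entry ⟩
      det (λ i j → scalar (- t) i j - A i j)
        ≈⟨ charPoly (- t) ⟩
      product (λ i → - t - eigenvalue i)
        ≈⟨ product-scale n (λ i → - t - eigenvalue i) (λ i → t + eigenvalue i) ε (λ i → -x-y≈ε*[x+y] t (eigenvalue i)) ⟩
      ε ^ n * product (λ i → t + eigenvalue i) ∎)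
      where
      entry : ∀ i j → ε * (scalar t i j + A i j) ≈ scalar (- t) i j - A i j
      entry i j with does (i Fin.≟ j)
      ... | true  = sym (-x-y≈ε*[x+y] t (A i j))
      ... | false = trans (sym (-x-y≈ε*[x+y] 0# (A i j))) (+-congʳ -0#≈0#)

    Det-#0 : Det E # 0#
    Det-#0 = nonzero-product-#0 n eigenvalue

    Det-zero : (∀ i j → A i j ≈ 0#) → Det E ≈ 1#
    -- Two empty spectra, each with product 1, stand on the right, and the factor t^n carries the
    -- whole determinant.
    Det-zero A≈0 = trans (nonzero-product-* {m = 0} {0} eigenvalue (λ ()) (λ ()) 0 n (λ t → begin
      1# * product (λ i → t + eigenvalue i)
        ≈⟨ *-identityˡ _ ⟩
      product (λ i → t + eigenvalue i)
        ≈⟨ det-shift t ⟨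
      det (scalar t ⊞ A)
        ≈⟨ trans (det-cong n (λ i j → trans (+-congˡ (A≈0 i j)) (+-identityʳ _))) (det-scalar n t) ⟩
      t ^ n
        ≈⟨ trans (*-congˡ (*-identityˡ 1#)) (*-identityʳ _) ⟨
      t ^ n * (1# * 1#) ∎)) (*-identityˡ 1#)

  Det-⊞ : ∀ {m n} {X : Matrix n n} {A : Matrix n m} {B : Matrix m n} → (∀ i j → (X ⊠ (A ⊠ B)) i j ≈ 0#) →
    (E₁ : Eigenvalues (X ⊞ (A ⊠ B))) (E₂ : Eigenvalues X) (E₃ : Eigenvalues (B ⊠ A)) →
    Det E₁ ≈ Det E₂ * Det E₃
  Det-⊞ {m} {n} {X} {A} {B} XAB≈0 E₁ E₂ E₃ =
    -- On the left, t^n pays for splitting det (t + X + AB) and t^m for exchanging AB with BA; the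
    -- exchange returns the t^n on the right.
    nonzero-product-* (eigenvalue E₁) (eigenvalue E₂) (eigenvalue E₃) (m ℕ.+ n) n (λ t → begin
      t ^ (m ℕ.+ n) * product (λ i → t + eigenvalue E₁ i)
        ≈⟨ *-cong (^-homo-* t m n) (sym (det-shift E₁ t)) ⟩
      (t ^ m * t ^ n) * det (scalar t ⊞ (X ⊞ (A ⊠ B)))
        ≈⟨ trans (*-assoc _ _ _) (*-congˡ (sym (det-⊞-orthogonal X (A ⊠ B) XAB≈0 t))) ⟩
      t ^ m * (det (scalar t ⊞ X) * det (scalar t ⊞ (A ⊠ B)))
        ≈⟨ solve 3 (λ p x y → p :* (x :* y) := x :* (p :* y)) refl (t ^ m) (det (scalar t ⊞ X)) _ ⟩
      det (scalar t ⊞ X) * (t ^ m * det (scalar t ⊞ (A ⊠ B)))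
        ≈⟨ *-congˡ (det-exchange A B t) ⟨
      det (scalar t ⊞ X) * (t ^ n * det (scalar t ⊞ (B ⊠ A)))
        ≈⟨ *-cong (det-shift E₂ t) (*-congˡ (det-shift E₃ t)) ⟩
      product (λ i → t + eigenvalue E₂ i) * (t ^ n * product (λ i → t + eigenvalue E₃ i))
        ≈⟨ solve 3 (λ x p y → x :* (p :* y) := p :* (x :* y)) refl _ (t ^ n) _ ⟩
      t ^ n * (product (λ i → t + eigenvalue E₂ i) * product (λ i → t + eigenvalue E₃ i)) ∎)
    where open Eigenvalues

-- Faces of simplices, their enumeration, and d d = 0.

removeAt-∷ : ∀ {a} {A : Set a} {n} x (xs : Vec A (suc n)) i → Vec.removeAt (x ∷ xs) (suc i) ≡ x ∷ Vec.removeAt xs i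
removeAt-∷ x (_ ∷ _) i = ≡.refl

-- The simplicial identity for iterated faces, phrased with the same involution as
-- `alternating-sum`.
removeAt-removeAt : ∀ {a} {A : Set a} {n} (xs : Vec A (suc (suc n))) i j →
  Vec.removeAt (Vec.removeAt xs i) j ≡ Vec.removeAt (Vec.removeAt xs (punchIn i j)) (pinch j i)
removeAt-removeAt (x ∷ y ∷ xs)     zero    j       = ≡.refl
removeAt-removeAt (x ∷ y ∷ xs)     (suc i) zero    = ≡.refl
removeAt-removeAt (x ∷ y ∷ z ∷ xs) (suc i) (suc j) = begin
  Vec.removeAt (x ∷ Vec.removeAt (y ∷ z ∷ xs) i) (suc j)
    ≡⟨ removeAt-∷ x (Vec.removeAt (y ∷ z ∷ xs) i) j ⟩
  x ∷ Vec.removeAt (Vec.removeAt (y ∷ z ∷ xs) i) j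
    ≡⟨ ≡.cong (x ∷_) (removeAt-removeAt (y ∷ z ∷ xs) i j) ⟩
  x ∷ Vec.removeAt (Vec.removeAt (y ∷ z ∷ xs) (punchIn i j)) (pinch j i)
    ≡⟨ removeAt-∷ x (Vec.removeAt (y ∷ z ∷ xs) (punchIn i j)) (pinch j i) ⟨
  Vec.removeAt (x ∷ Vec.removeAt (y ∷ z ∷ xs) (punchIn i j)) (suc (pinch j i)) ∎
  where open ≡.≡-Reasoning

All-removeAt : ∀ {a p} {A : Set a} {P : A → Set p} {n} (xs : Vec A (suc n)) i → All P xs → All P (Vec.removeAt xs i)
All-removeAt (x ∷ xs)     zero    (px ∷ pxs) = pxs
All-removeAt (x ∷ y ∷ xs) (suc i) (px ∷ pxs) = px ∷ All-removeAt (y ∷ xs) i pxs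

AllPairs-removeAt : ∀ {a ℓ} {A : Set a} {_~_ : A → A → Set ℓ} {n} (xs : Vec A (suc n)) i →
  AllPairs _~_ xs → AllPairs _~_ (Vec.removeAt xs i)
AllPairs-removeAt (x ∷ xs)     zero    (px ∷ pxs) = pxs
AllPairs-removeAt (x ∷ y ∷ xs) (suc i) (px ∷ pxs) = All-removeAt (y ∷ xs) i px ∷ AllPairs-removeAt (y ∷ xs) i pxs

module Simplices (G : Graph) where
  open Graph G

  ∈-tuples : ∀ {m} (x : Vec (Fin order) m) → x ∈ tuples G m
  ∈-tuples []      = here ≡.refl
  ∈-tuples (v ∷ x) = ∈-cartesianProductWith⁺ _∷_ (∈-allFin v) (∈-tuples x)

  tuples-unique : ∀ m → Unique (tuples G m)
  tuples-unique zero    = ListAll.[] ∷ []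
  tuples-unique (suc m) = cartesianProductWith⁺ _∷_ ∷-injective (allFin⁺ order) (tuples-unique m)

  simplices-unique : ∀ k → Unique (simplices G k)
  simplices-unique k = filter⁺ (isSimplex? G) (tuples-unique (suc k))

  simplex-isSimplex : ∀ {k} (x : Fin (f G k)) → IsSimplex G (simplex G x)
  simplex-isSimplex {k} x = proj₂ (∈-filter⁻ (isSimplex? G) {xs = tuples G (suc k)} (∈-lookup x))

  face∈simplices : ∀ {k} (x : Fin (f G (suc k))) i → Vec.removeAt (simplex G x) i ∈ simplices G k
  face∈simplices x i = ∈-filter⁺ (isSimplex? G) (∈-tuples _)
    (AllPairs-removeAt (simplex G x) i (simplex-isSimplex x))

  no-simplices : ∀ r → IsMaxDim G r → ¬ Fin (f G (suc r))
  no-simplices r (_ , bound) x = ℕ.1+n≰n (bound (simplex G x) (simplex-isSimplex x))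

module Coboundaries {c ℓ₁ ℓ₂} (K : HeytingField c ℓ₁ ℓ₂) (_#?_ : Decidable (HeytingField._#_ K)) (G : Graph) where

  open OverField K _#?_ using (_^_; Matrix; _⊠_; _ᵀ; incidence; d; D)
  open Determinants K _#?_
  open CharacteristicDeterminants K _#?_ using (⊠-assoc)
  open Simplices G
  open CommutativeRing R hiding (zero)
  open SemiringSum semiring
  open SetoidReasoning setoid

  -- Membership provides the surviving term and uniqueness kills all others. Applied to the list of
  -- simplices, this turns a sum over all simplices into a sum over the faces of one.
  select-sum : ∀ {a} {A : Set a} (_≟_ : DecidableEquality A) {v : A} {xs : List A} → Unique xs → v ∈ xs →
    ∀ s (h : A → Carrier) →
    sum (λ y → (if does (List.lookup xs y ≟ v) then s else 0#) * h (List.lookup xs y)) ≈ s * h v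
  select-sum _≟_ {v} {x ∷ xs} (x∉xs ∷ _) (here ≡.refl) s h with v ≟ v
  ... | no  v≢v = contradiction ≡.refl v≢v
  ... | yes _   = trans (+-congˡ (sum-zero (List.length xs) rest)) (+-identityʳ _)
    where
    rest : ∀ y → (if does (List.lookup xs y ≟ v) then s else 0#) * h (List.lookup xs y) ≈ 0#
    rest y with List.lookup xs y ≟ v
    ... | yes y≡v = contradiction (≡.sym y≡v) (ListAll.lookup x∉xs (∈-lookup y))
    ... | no  _   = zeroˡ _
  select-sum _≟_ {v} {x ∷ xs} (x∉xs ∷ unique) (there v∈xs) s h with x ≟ v
  ... | yes x≡v = contradiction x≡v (ListAll.lookup x∉xs v∈xs)
  ... | no  _   = trans (+-cong (zeroˡ _) (select-sum _≟_ unique v∈xs s h)) (+-identityˡ _)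

  -- Every face of `x` occurs exactly once among the simplices, so the matrix product becomes a
  -- double alternating sum over deletions of two vertices, whose terms depend only on the face that
  -- remains.
  d∘d≈0 : ∀ k x z → (d G (suc k) ⊠ d G k) x z ≈ 0#
  d∘d≈0 k x z = begin
    sum (λ y → incidence G X (simplex G y) * H (simplex G y))
      ≈⟨ ∑-cong (f G (suc k)) (λ y → *-distribʳ-sum {suc (suc (suc k))} (H (simplex G y)) (I y)) ⟩
    sum (λ y → sum (λ i → I y i * H (simplex G y)))
      ≈⟨ ∑-comm {f G (suc k)} {suc (suc (suc k))} (λ y i → I y i * H (simplex G y)) ⟩
    sum (λ i → sum (λ y → I y i * H (simplex G y)))
      ≈⟨ ∑-cong (suc (suc (suc k))) (λ i → trans
           (select-sum (_≟ᵛ_ G) (simplices-unique (suc k)) (face∈simplices x i) (ε ^ toℕ i) H)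
           (*-congˡ (∑-cong (suc (suc k)) (λ j → factor (does (_≟ᵛ_ G (simplex G z) (Vec.removeAt (Vec.removeAt X i) j))) (ε ^ toℕ j))))) ⟩
    sum (λ i → ε ^ toℕ i * sum (λ j → ε ^ toℕ j * δ (Vec.removeAt (Vec.removeAt X i) j)))
      ≈⟨ alternating-sum (λ i j → δ (Vec.removeAt (Vec.removeAt X i) j))
           (λ i j → reflexive (≡.cong δ (removeAt-removeAt X i j))) ⟩
    0# ∎
    where
    X : Vec (Fin (Graph.order G)) (suc (suc (suc k)))
    X = simplex G x
    H : Vec (Fin (Graph.order G)) (suc (suc k)) → Carrier
    H y = incidence G y (simplex G z)
    I : Fin (f G (suc k)) → Fin (suc (suc (suc k))) → Carrier
    I y i = if does (_≟ᵛ_ G (simplex G y) (Vec.removeAt X i)) then ε ^ toℕ i else 0#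
    δ : Vec (Fin (Graph.order G)) (suc k) → Carrier
    δ v = if does (_≟ᵛ_ G (simplex G z) v) then 1# else 0#
    factor : ∀ b s → (if b then s else 0#) ≈ s * (if b then 1# else 0#)
    factor true  s = sym (*-identityʳ s)
    factor false s = sym (zeroʳ s)

  D⊠ddᵀ≈0 : ∀ k i j → (D G (suc k) ⊠ (d G k ⊠ (d G k ᵀ))) i j ≈ 0#
  D⊠ddᵀ≈0 k i j = begin
    (((d₁ ᵀ) ⊠ d₁) ⊠ (d₀ ⊠ (d₀ ᵀ))) i j
      ≈⟨ ⊠-assoc (d₁ ᵀ) d₁ (d₀ ⊠ (d₀ ᵀ)) i j ⟩
    ((d₁ ᵀ) ⊠ (d₁ ⊠ (d₀ ⊠ (d₀ ᵀ)))) i j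
      ≈⟨ sum-zero (f G (suc (suc k))) (λ x → trans (*-congˡ (inner x)) (zeroʳ _)) ⟩
    0# ∎
    where
    d₀ : Matrix (f G (suc k)) (f G k)
    d₀ = d G k
    d₁ : Matrix (f G (suc (suc k))) (f G (suc k))
    d₁ = d G (suc k)
    inner : ∀ x → (d₁ ⊠ (d₀ ⊠ (d₀ ᵀ))) x j ≈ 0#
    inner x = trans (sym (⊠-assoc d₁ d₀ (d₀ ᵀ) x j))
      (sum-zero (f G k) (λ z → trans (*-congʳ (d∘d≈0 k x z)) (zeroˡ _)))

  -- The convention d_r = 0 is not built into `d`: it results from the maximality of `r`, which
  -- makes this a sum over the empty set of (r+1)-simplices.
  D-top≈0 : ∀ r → IsMaxDim G r → ∀ i j → D G r i j ≈ 0#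
  D-top≈0 r maxDim i j = sum-zero (f G (suc r)) (λ x → contradiction x (no-simplices r maxDim))

-- Integer powers and the telescoping product.

module IntegerPowers {c ℓ₁ ℓ₂} (K : HeytingField c ℓ₁ ℓ₂) (_#?_ : Decidable (HeytingField._#_ K))
  (charZero : OverField.CharZero K _#?_) where

  open OverField K _#?_ using (_^_; _⁻¹; _^ᶻ_; product)
  open Determinants K _#?_ using (R)
  open CharacteristicDeterminants K _#?_ using (1^n≈1)
  open PseudoDeterminants K _#?_ charZero
  open HeytingField K using (_#_; #⇒invertible)
  open CommutativeRing R hiding (zero)
  open SemiringExp semiring using (^-congˡ)
  open CommutativeSemiringExp commutativeSemiring using (^-distrib-*)
  open SemiringSolver commutativeSemiring using (solve; _:=_; _:*_)
  open SetoidReasoning setoid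

  *-inverseʳ : ∀ {x} → x # 0# → x * x ⁻¹ ≈ 1#
  *-inverseʳ {x} x#0 with x #? 0#
  ... | yes p   = trans (*-congʳ (sym (x-0≈x x))) (proj₂ (proj₂ (#⇒invertible p)))
  ... | no ¬x#0 = contradiction x#0 ¬x#0

  -- The value of `_⁻¹` depends on the apartness proof returned by the decision, so its congruence
  -- and multiplicativity are drawn from uniqueness of inverses.
  ⁻¹-unique : ∀ {x y} → x # 0# → x * y ≈ 1# → y ≈ x ⁻¹
  ⁻¹-unique x#0 x*y≈1 = *-cancelˡ-#0 x#0 (trans x*y≈1 (sym (*-inverseʳ x#0)))

  ⁻¹-cong : ∀ {x y} → x # 0# → x ≈ y → x ⁻¹ ≈ y ⁻¹
  ⁻¹-cong x#0 x≈y = ⁻¹-unique (#0-resp-≈ x≈y x#0) (trans (*-congʳ (sym x≈y)) (*-inverseʳ x#0))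

  ⁻¹-distrib-* : ∀ {x y} → x # 0# → y # 0# → (x * y) ⁻¹ ≈ x ⁻¹ * y ⁻¹
  ⁻¹-distrib-* {x} {y} x#0 y#0 = sym (⁻¹-unique (*-#0 x#0 y#0) (begin
    (x * y) * (x ⁻¹ * y ⁻¹)   ≈⟨ solve 4 (λ x y x′ y′ → (x :* y) :* (x′ :* y′) := (x :* x′) :* (y :* y′)) refl x y (x ⁻¹) (y ⁻¹) ⟩
    (x * x ⁻¹) * (y * y ⁻¹)   ≈⟨ *-cong (*-inverseʳ x#0) (*-inverseʳ y#0) ⟩
    1# * 1#                   ≈⟨ *-identityˡ 1# ⟩
    1#                        ∎))

  ^ᶻ-congˡ : ∀ {x y} m → x # 0# → x ≈ y → x ^ᶻ m ≈ y ^ᶻ m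
  ^ᶻ-congˡ (+ n)    x#0 x≈y = ^-congˡ n x≈y
  ^ᶻ-congˡ -[1+ n ] x#0 x≈y = ^-congˡ (suc n) (⁻¹-cong x#0 x≈y)

  1^ᶻm≈1 : ∀ m → 1# ^ᶻ m ≈ 1#
  1^ᶻm≈1 (+ n)    = 1^n≈1 n
  1^ᶻm≈1 -[1+ n ] = trans (^-congˡ (suc n) (sym (⁻¹-unique 1#0 (*-identityˡ 1#)))) (1^n≈1 (suc n))

  ^ᶻ-distrib-* : ∀ {x y} m → x # 0# → y # 0# → (x * y) ^ᶻ m ≈ x ^ᶻ m * y ^ᶻ m
  ^ᶻ-distrib-* {x} {y} (+ n)    x#0 y#0 = ^-distrib-* x y n
  ^ᶻ-distrib-* {x} {y} -[1+ n ] x#0 y#0 = trans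
    (^-congˡ (suc n) (⁻¹-distrib-* x#0 y#0)) (^-distrib-* (x ⁻¹) (y ⁻¹) (suc n))

  ^ᶻ-⊖ : ∀ {x} m n → x # 0# → x ^ᶻ (m ℤ.⊖ n) ≈ x ^ m * (x ⁻¹) ^ n
  ^ᶻ-⊖ m       zero    x#0 = sym (*-identityʳ _)
  ^ᶻ-⊖ zero    (suc n) x#0 = sym (*-identityˡ _)
  ^ᶻ-⊖ {x} (suc m) (suc n) x#0 = begin
    x ^ᶻ (suc m ℤ.⊖ suc n)               ≈⟨ reflexive (≡.cong (x ^ᶻ_) (ℤ.[1+m]⊖[1+n]≡m⊖n m n)) ⟩
    x ^ᶻ (m ℤ.⊖ n)                       ≈⟨ ^ᶻ-⊖ m n x#0 ⟩
    x ^ m * (x ⁻¹) ^ n                   ≈⟨ *-identityˡ _ ⟨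
    1# * (x ^ m * (x ⁻¹) ^ n)            ≈⟨ *-congʳ (*-inverseʳ x#0) ⟨
    (x * x ⁻¹) * (x ^ m * (x ⁻¹) ^ n)    ≈⟨ solve 4 (λ x y p q → (x :* y) :* (p :* q) := (x :* p) :* (y :* q)) refl x (x ⁻¹) (x ^ m) ((x ⁻¹) ^ n) ⟩
    x ^ suc m * (x ⁻¹) ^ suc n           ∎

  ^ᶻ-homo-+ : ∀ {x} m n → x # 0# → x ^ᶻ (m ℤ.+ n) ≈ x ^ᶻ m * x ^ᶻ n
  ^ᶻ-homo-+ {x} (+ m)    (+ n)    x#0 = SemiringExp.^-homo-* semiring x m n
  ^ᶻ-homo-+     (+ m)    -[1+ n ] x#0 = ^ᶻ-⊖ m (suc n) x#0
  ^ᶻ-homo-+     -[1+ m ] (+ n)    x#0 = trans (^ᶻ-⊖ n (suc m) x#0) (*-comm _ _)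
  ^ᶻ-homo-+ {x} -[1+ m ] -[1+ n ] x#0 = trans
    (reflexive (≡.cong ((x ⁻¹) ^_) (≡.cong suc (≡.sym (ℕ.+-suc m n)))))
    (SemiringExp.^-homo-* semiring (x ⁻¹) (suc m) (suc n))

  -- `w` plays the part of x at index -1 and becomes `x zero` in the induction, so that each x
  -- collects the exponents e k and e (k + 1). The condition on the first term is imposed after
  -- raising to `e 0`, which makes it trivial when that exponent is 0.
  telescope : ∀ r (e g : ℕ → ℤ) → (∀ k → e k ℤ.+ e (suc k) ≡ g k) →
    (x y : Fin (suc r) → Carrier) (w : Carrier) → (∀ k → x k # 0#) → (∀ k → y k # 0#) → w # 0# →
    y zero ^ᶻ e 0 ≈ (x zero * w) ^ᶻ e 0 →
    (∀ k → y (suc k) ≈ x (suc k) * x (Fin.inject₁ k)) →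
    x (Fin.fromℕ r) ≈ 1# →
    product (λ k → y k ^ᶻ e (toℕ k)) ≈ w ^ᶻ e 0 * product (λ k → x k ^ᶻ g (toℕ k))
  telescope zero e g e-g x y w x#0 y#0 w#0 y₀ yₛ x-last = begin
    y zero ^ᶻ e 0 * 1#                   ≈⟨ trans (*-identityʳ _) y₀ ⟩
    (x zero * w) ^ᶻ e 0                  ≈⟨ ^ᶻ-congˡ (e 0) (*-#0 (x#0 zero) w#0) (trans (*-congʳ x-last) (*-identityˡ w)) ⟩
    w ^ᶻ e 0                             ≈⟨ *-identityʳ _ ⟨
    w ^ᶻ e 0 * 1#                        ≈⟨ *-congˡ (1^ᶻm≈1 (g 0)) ⟨
    w ^ᶻ e 0 * 1# ^ᶻ g 0                 ≈⟨ *-congˡ (^ᶻ-congˡ (g 0) (x#0 zero) x-last) ⟨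
    w ^ᶻ e 0 * x zero ^ᶻ g 0             ≈⟨ *-congˡ (*-identityʳ _) ⟨
    w ^ᶻ e 0 * (x zero ^ᶻ g 0 * 1#)      ∎
  telescope (suc r) e g e-g x y w x#0 y#0 w#0 y₀ yₛ x-last = begin
    y zero ^ᶻ e 0 * product (λ k → y (suc k) ^ᶻ e (suc (toℕ k)))
      ≈⟨ *-cong (trans y₀ (^ᶻ-distrib-* (e 0) (x#0 zero) w#0))
           (telescope r (λ k → e (suc k)) (λ k → g (suc k)) (λ k → e-g (suc k))
             (λ k → x (suc k)) (λ k → y (suc k)) (x zero) (λ k → x#0 (suc k)) (λ k → y#0 (suc k)) (x#0 zero)
             (^ᶻ-congˡ (e 1) (y#0 (suc zero)) (yₛ zero)) (λ k → yₛ (suc k)) x-last) ⟩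
    (x zero ^ᶻ e 0 * w ^ᶻ e 0) * (x zero ^ᶻ e 1 * product (λ k → x (suc k) ^ᶻ g (suc (toℕ k))))
      ≈⟨ solve 4 (λ a b c p → (a :* b) :* (c :* p) := b :* ((a :* c) :* p)) refl (x zero ^ᶻ e 0) (w ^ᶻ e 0) (x zero ^ᶻ e 1) _ ⟩
    w ^ᶻ e 0 * ((x zero ^ᶻ e 0 * x zero ^ᶻ e 1) * product (λ k → x (suc k) ^ᶻ g (suc (toℕ k))))
      ≈⟨ *-congˡ (*-congʳ (trans (reflexive (≡.cong (x zero ^ᶻ_) (≡.sym (e-g 0)))) (^ᶻ-homo-+ (e 0) (e 1) (x#0 zero)))) ⟨
    w ^ᶻ e 0 * (x zero ^ᶻ g 0 * product (λ k → x (suc k) ^ᶻ g (suc (toℕ k)))) ∎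

-- Det D_k occurs in Det L_k and in Det L_{k+1}; the two torsion exponents add up to (-1)^k ((k + 1)
-- - k).
exponents : ∀ k →
  (+ k) ℤ.* ((ℤ.- (+ 1)) ℤ.^ suc k) ℤ.+ (+ suc k) ℤ.* ((ℤ.- (+ 1)) ℤ.^ suc (suc k)) ≡ (ℤ.- (+ 1)) ℤ.^ k
exponents k = solve 2 (λ n s →
  n :* (con (ℤ.- (+ 1)) :* s) :+ (con (+ 1) :+ n) :* (con (ℤ.- (+ 1)) :* (con (ℤ.- (+ 1)) :* s)) := s)
  ≡.refl (+ k) ((ℤ.- (+ 1)) ℤ.^ k)
  where open +-*-Solver

mainTheorem2 : ∀ {c ℓ₁ ℓ₂} (K : HeytingField c ℓ₁ ℓ₂) (_#?_ : Decidable (HeytingField._#_ K)) →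
    let open HeytingField K using (_≈_)
        open OverField K _#?_
    in CharZero →
       (G : Graph) (r : ℕ) → IsMaxDim G r →
       (specL : (k : Fin (suc r)) → Eigenvalues (L G (toℕ k))) →
       (specD : (k : Fin (suc r)) → Eigenvalues (D G (toℕ k))) →
       torsion G r specL ≈ SDet G r specD
mainTheorem2 K _#?_ charZero G r maxDim specL specD = trans
  (telescope r (λ k → (+ k) ℤ.* ((ℤ.- (+ 1)) ℤ.^ suc k)) (λ k → (ℤ.- (+ 1)) ℤ.^ k) exponents
    (λ k → Det (specD k)) (λ k → Det (specL k)) 1#
    (λ k → Det-#0 (specD k)) (λ k → Det-#0 (specL k)) 1#0
    -- The torsion exponent at k = 0 is 0, so both powers compute to 1, although the spectra given
    -- for L_0 and D_0 are unrelated data.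
    refl
    (λ k → Det-L k (specD (Fin.inject₁ k)) (Fin.toℕ-inject₁ k))
    (Det-D-top (specD (Fin.fromℕ r)) (Fin.toℕ-fromℕ r)))
  (trans (*-congʳ (1^ᶻm≈1 (+ 0))) (*-identityˡ _))
  where
  open OverField K _#?_
  open Determinants K _#?_ using (R)
  open PseudoDeterminants K _#?_ charZero
  open Coboundaries K _#?_ G
  open IntegerPowers K _#?_ charZero
  open CommutativeRing R hiding (zero)
  -- The free index `j` absorbs the merely propositional equality of `toℕ (inject₁ k)` with `toℕ k`,
  -- so that no spectrum has to be transported.
  Det-L : ∀ k {j} (E : Eigenvalues (D G j)) → j ≡ toℕ k → Det (specL (suc k)) ≈ Det (specD (suc k)) * Det E
  Det-L k E ≡.refl = Det-⊞ (D⊠ddᵀ≈0 (toℕ k)) (specL (suc k)) (specD (suc k)) E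
  Det-D-top : ∀ {j} (E : Eigenvalues (D G j)) → j ≡ r → Det E ≈ 1#
  Det-D-top E ≡.refl = Det-zero E (D-top≈0 r maxDim)
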